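{- Let $k,m,i,N$ be nonnegative integers such that $k\ge2$, $i\le k$, $2\le m\le 2^k$ and \[ N\ge \exp^{i+1}_2(k+2\log k+2). \] Then for every $\varphi:\binom{[N]}{\le k}\to[m]$ there exists $V\subseteq[N]$, $|V|=k$, such that the number of colors $\varphi(X)$ for subsets $X\subseteq V$ is at most $2^{k-i}+i$. Hence the entropy of $\varphi(X)$ on such a source $X$ (i.e. for $X$ a uniformly random subset of $V$) is at most $\log(2^{k-i}+i)$.
   Context: $[n]=\{1,\dots,n\}$; $\binom{[N]}{\le k}$ is the set of all subsets of $[N]$ of cardinality at most $k$. All logarithms are in base 2. The iterated exponential is defined by $\exp_r^0(x)=x$ and $\exp_r^{j+1}(x)=r^{\exp_r^{j}(x)}$ (a tower of $j$ copies of $r$ with $x$ on top). The entropy of a random variable $Y$ with finite range $R$ is $\mathrm{H}[Y]=\sum_{r\in R}\Pr[Y=r]\log\frac1{\Pr[Y=r]}$. -}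

module Defs where

open import Algebra.Bundles using (CommutativeRing)
open import Data.Fin using (Fin)
import Data.Fin.Properties as Fin
open import Data.Fin.Subset using (Subset; inside; outside; _⊆_; ∣_∣; ⊥)
open import Data.Fin.Subset.Properties using (_⊆?_; ⊥⊆; p⊆q⇒∣p∣≤∣q∣)
import Data.Integer as ℤ
import Data.Integer.Properties as ℤ
open import Data.Integer using (ℤ; +_; -[1+_])
open import Data.List using (List; []; _∷_; _++_; map; filter; length; deduplicate; foldr)
open import Data.List.Membership.Propositional using (_∈_)
open import Data.List.Membership.Propositional.Properties
  using (∈-++⁺ˡ; ∈-++⁺ʳ; ∈-map⁺; ∈-filter⁺)
open import Data.List.Relation.Unary.All as All using (All; []; _∷_)
open import Data.List.Relation.Unary.All.Properties using (all-filter)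
open import Data.List.Relation.Unary.Any using (here)
open import Data.Nat as ℕ using (ℕ; zero; suc; z≤n; s≤s)
import Data.Nat.Properties as ℕ
open import Data.Product using (Σ-syntax; ∃; ∃-syntax; ∃₂; _×_; _,_; proj₁; proj₂)
open import Data.Rational hiding (∣_∣)
open import Data.Rational.Properties
import Data.Rational.Unnormalised as ℚᵘ
import Data.Rational.Unnormalised.Properties as ℚᵘ
open import Data.Vec using ([]; _∷_)
open import Relation.Binary.PropositionalEquality
open import Relation.Nullary using (¬_; yes; no)

open import Algebra.Properties.Semiring.Exp
  (CommutativeRing.semiring +-*-commutativeRing)
  using (_^_; ^-assocʳ)

------------------------------------------------------------------------
-- Powers of rationals

ℕ→ℚ : ℕ → ℚ
ℕ→ℚ n = + n / 1

2ℚ : ℚ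
2ℚ = ℕ→ℚ 2

instance
  2ℚ-nonNegative : NonNegative 2ℚ
  2ℚ-nonNegative = _

pow2 : ℤ → ℚ
pow2 (+ n)    = 2ℚ ^ n
pow2 -[1+ n ] = ½ ^ suc n

^-pos : ∀ a .{{_ : Positive a}} n → Positive (a ^ n)
^-pos a zero    = _
^-pos a (suc n) = pos*pos⇒pos a (a ^ n) {{^-pos a n}}

^-nonNeg : ∀ a → 0ℚ ≤ a → ∀ n → 0ℚ ≤ a ^ n
^-nonNeg a 0≤a zero    = nonNegative⁻¹ 1ℚ
^-nonNeg a 0≤a (suc n) = nonNegative⁻¹ (a * a ^ n)
  {{nonNeg*nonNeg⇒nonNeg a {{nonNegative 0≤a}} (a ^ n) {{nonNegative (^-nonNeg a 0≤a n)}}}}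

^-monoˡ-≤ : ∀ {a b} → 0ℚ ≤ a → a ≤ b → ∀ n → a ^ n ≤ b ^ n
^-monoˡ-≤ 0≤a a≤b zero = ≤-refl
^-monoˡ-≤ {a} {b} 0≤a a≤b (suc n) = ≤-trans
  (*-monoˡ-≤-nonNeg a {{nonNegative 0≤a}} (^-monoˡ-≤ 0≤a a≤b n))
  (*-monoʳ-≤-nonNeg (b ^ n) {{nonNegative (^-nonNeg b (≤-trans 0≤a a≤b) n)}} a≤b)

1≤2^ : ∀ n → 1ℚ ≤ 2ℚ ^ n
1≤2^ zero    = ≤-refl
1≤2^ (suc n) = ≤-trans (1≤2^ n)
  (subst (_≤ 2ℚ * 2ℚ ^ n) (*-identityˡ (2ℚ ^ n))
    (*-monoʳ-≤-nonNeg (2ℚ ^ n) {{pos⇒nonNeg (2ℚ ^ n) {{^-pos 2ℚ n}}}} (<⇒≤ 1<2)))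
  where
  1<2 : 1ℚ < 2ℚ
  1<2 = *<* (ℤ.+<+ (s≤s (s≤s z≤n)))

2^-mono : ∀ {m n} → m ℕ.≤ n → 2ℚ ^ m ≤ 2ℚ ^ n
2^-mono {n = n} z≤n = 1≤2^ n
2^-mono (s≤s m≤n)   = *-monoˡ-≤-nonNeg 2ℚ (2^-mono m≤n)

½^≤1 : ∀ n → ½ ^ n ≤ 1ℚ
½^≤1 zero    = ≤-refl
½^≤1 (suc n) = ≤-trans (*-monoˡ-≤-nonNeg ½ (½^≤1 n)) (*≤* (ℤ.+≤+ (s≤s z≤n)))

pow2-pos : ∀ n → Positive (pow2 n)
pow2-pos (+ n)    = ^-pos 2ℚ n
pow2-pos -[1+ n ] = ^-pos ½ (suc n)

pow2≤ : ∀ {n t} → n ℤ.≤ + t → pow2 n ≤ 2ℚ ^ t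
pow2≤ {+ n}    (ℤ.+≤+ n≤t) = 2^-mono n≤t
pow2≤ { -[1+ n ]} {t} _ = ≤-trans (½^≤1 (suc n)) (1≤2^ t)

≤pow2 : ∀ {n t} → + t ℤ.≤ n → 2ℚ ^ t ≤ pow2 n
≤pow2 (ℤ.+≤+ t≤n) = 2^-mono t≤n

toℚᵘ-/ : ∀ n d → toℚᵘ (n / suc d) ℚᵘ.≃ ℚᵘ.mkℚᵘ n d
toℚᵘ-/ n d = toℚᵘ-fromℚᵘ (ℚᵘ.mkℚᵘ n d)

clear-≤ : ∀ n d t → n / suc d ≤ ℕ→ℚ t → n ℤ.≤ + (t ℕ.* suc d)
clear-≤ n d t le
  with ℚᵘ.≤-respˡ-≃ (toℚᵘ-/ n d) (ℚᵘ.≤-respʳ-≃ (toℚᵘ-/ (+ t) 0) (toℚᵘ-mono-≤ le))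
... | ℚᵘ.*≤* le′ = subst₂ ℤ._≤_ (ℤ.*-identityʳ n) (sym (ℤ.pos-* t (suc d))) le′

clear-≥ : ∀ n d t → ℕ→ℚ t ≤ n / suc d → + (t ℕ.* suc d) ℤ.≤ n
clear-≥ n d t le
  with ℚᵘ.≤-respˡ-≃ (toℚᵘ-/ (+ t) 0) (ℚᵘ.≤-respʳ-≃ (toℚᵘ-/ n d) (toℚᵘ-mono-≤ le))
... | ℚᵘ.*≤* le′ = subst₂ ℤ._≤_ (sym (ℤ.pos-* t (suc d))) (ℤ.*-identityʳ n) le′

ℕ→ℚ-mono : ∀ {m n} → m ℕ.≤ n → ℕ→ℚ m ≤ ℕ→ℚ n
ℕ→ℚ-mono {m} {n} m≤n = toℚᵘ-cancel-≤
  (ℚᵘ.≤-respˡ-≃ (ℚᵘ.≃-sym (toℚᵘ-/ (+ m) 0)) (ℚᵘ.≤-respʳ-≃ (ℚᵘ.≃-sym (toℚᵘ-/ (+ n) 0))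
    (ℚᵘ.*≤* (ℤ.*-monoʳ-≤-nonNeg (+ 1) (ℤ.+≤+ m≤n)))))

archimedean : ∀ a → ∃[ t ] a ≤ ℕ→ℚ t
archimedean a@(mkℚ n d _) = ℤ.∣ n ∣ , toℚᵘ-cancel-≤
  (ℚᵘ.≤-respʳ-≃ (ℚᵘ.≃-sym (toℚᵘ-/ (+ ℤ.∣ n ∣) 0)) (ℚᵘ.*≤* (step n)))
  where
  step : ∀ n → n ℤ.* + 1 ℤ.≤ + ℤ.∣ n ∣ ℤ.* + suc d
  step (+ n)    = subst₂ ℤ._≤_ (sym (ℤ.*-identityʳ (+ n))) (ℤ.pos-* n (suc d))
                    (ℤ.+≤+ (ℕ.m≤m*n n (suc d)))
  step -[1+ n ] = ℤ.-≤+

ℕ→ℚ-≤-2^ : ∀ t → ℕ→ℚ t ≤ 2ℚ ^ t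
ℕ→ℚ-≤-2^ zero    = nonNegative⁻¹ 1ℚ
ℕ→ℚ-≤-2^ (suc t) = ≤-trans
  (≤-reflexive suc-/)
  (≤-trans (+-mono-≤ (1≤2^ t) (ℕ→ℚ-≤-2^ t)) (≤-reflexive dbl))
  where
  suc-/ : ℕ→ℚ (suc t) ≡ 1ℚ + ℕ→ℚ t
  suc-/ = toℚᵘ-injective (ℚᵘ.≃-trans (toℚᵘ-/ (+ suc t) 0) (ℚᵘ.≃-sym
    (ℚᵘ.≃-trans (toℚᵘ-homo-+ 1ℚ (ℕ→ℚ t))
      (ℚᵘ.≃-trans (ℚᵘ.+-congʳ ℚᵘ.1ℚᵘ (toℚᵘ-/ (+ t) 0))
        (ℚᵘ.*≡* (cong (ℤ._* + 1) (cong (λ z → + 1 ℤ.+ z) (ℤ.*-identityʳ (+ t)))))))))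
  dbl : 2ℚ ^ t + 2ℚ ^ t ≡ 2ℚ * 2ℚ ^ t
  dbl = trans (cong₂ _+_ (sym (*-identityˡ (2ℚ ^ t))) (sym (*-identityˡ (2ℚ ^ t))))
              (sym (*-distribʳ-+ (2ℚ ^ t) 1ℚ 1ℚ))

≤2^ : ∀ a → ∃[ t ] a ≤ 2ℚ ^ t
≤2^ a with t , a≤t ← archimedean a = t , ≤-trans a≤t (ℕ→ℚ-≤-2^ t)

½^2^ : ∀ t → ½ ^ t * 2ℚ ^ t ≡ 1ℚ
½^2^ zero    = refl
½^2^ (suc t) = begin
  (½ * ½ ^ t) * (2ℚ * 2ℚ ^ t)   ≡⟨ *-assoc ½ (½ ^ t) (2ℚ * 2ℚ ^ t) ⟩
  ½ * (½ ^ t * (2ℚ * 2ℚ ^ t))   ≡⟨ cong (½ *_) (sym (*-assoc (½ ^ t) 2ℚ (2ℚ ^ t))) ⟩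
  ½ * ((½ ^ t * 2ℚ) * 2ℚ ^ t)   ≡⟨ cong (λ z → ½ * (z * 2ℚ ^ t)) (*-comm (½ ^ t) 2ℚ) ⟩
  ½ * ((2ℚ * ½ ^ t) * 2ℚ ^ t)   ≡⟨ cong (½ *_) (*-assoc 2ℚ (½ ^ t) (2ℚ ^ t)) ⟩
  ½ * (2ℚ * (½ ^ t * 2ℚ ^ t))   ≡⟨ cong (λ z → ½ * (2ℚ * z)) (½^2^ t) ⟩
  1ℚ                            ∎
  where open ≡-Reasoning

-- 1/a ≤ 2^t gives 2^-(t+1) < a
½^< : ∀ a → 0ℚ < a → ∃[ t ] ½ ^ suc t < a
½^< a 0<a = t , ≰⇒> contra
  where
  instance
    _ = positive 0<a
    _ = pos⇒nonZero a
  t : ℕ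
  t = proj₁ (≤2^ (1/ a))
  contra : ¬ (a ≤ ½ ^ suc t)
  contra le = <-irrefl refl (≤-<-trans one≤ ½<1)
    where
    instance
      _ = pos⇒nonNeg (½ ^ suc t) {{^-pos ½ (suc t)}}
      _ = pos⇒nonNeg (1/ a) {{1/pos⇒pos a}}
    ½<1 : ½ < 1ℚ
    ½<1 = *<* (ℤ.+<+ (s≤s (s≤s z≤n)))
    one≤ : 1ℚ ≤ ½
    one≤ = begin
      1ℚ                         ≡⟨ *-inverseʳ a ⟨
      a * 1/ a                   ≤⟨ *-monoʳ-≤-nonNeg (1/ a) le ⟩
      ½ ^ suc t * 1/ a           ≤⟨ *-monoˡ-≤-nonNeg (½ ^ suc t) (proj₂ (≤2^ (1/ a))) ⟩
      (½ * ½ ^ t) * 2ℚ ^ t       ≡⟨ *-assoc ½ (½ ^ t) (2ℚ ^ t) ⟩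
      ½ * (½ ^ t * 2ℚ ^ t)       ≡⟨ cong (½ *_) (½^2^ t) ⟩
      ½ * 1ℚ                     ≡⟨ *-identityʳ ½ ⟩
      ½                          ∎
      where open ≤-Reasoning

0^<pow2 : ∀ n d → 0ℚ ^ suc d < pow2 n
0^<pow2 n d = subst (_< pow2 n) (sym (*-zeroˡ (0ℚ ^ d))) (positive⁻¹ (pow2 n) {{pow2-pos n}})

q-1<q : ∀ q → q - 1ℚ < q
q-1<q q = subst (q - 1ℚ <_) (+-identityʳ q) (+-monoʳ-< q (negative⁻¹ (- 1ℚ)))

------------------------------------------------------------------------
-- Real numbers as Dedekind (lower) cuts: inhabited, bounded above, downward
-- closed sets of rationals without a greatest element.  No locatedness is
-- demanded, as the order below only compares lower cuts.

record ℝ : Set₁ where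
  field
    cut       : ℚ → Set
    inhabited : ∃ cut
    bounded   : ∃[ u ] (∀ {q} → cut q → q < u)
    downward  : ∀ {q r} → q < r → cut r → cut q
    rounded   : ∀ {q} → cut q → ∃[ r ] q < r × cut r

open ℝ public

infix 4 _≤ᴿ_
infixl 6 _+ᴿ_
infixr 7 _·_

_≤ᴿ_ : ℝ → ℝ → Set
x ≤ᴿ y = ∀ {q} → cut x q → cut y q

ℚ→ℝ : ℚ → ℝ
ℚ→ℝ a = record
  { cut       = _< a
  ; inhabited = a - 1ℚ , q-1<q a
  ; bounded   = a , λ q<a → q<a
  ; downward  = <-trans
  ; rounded   = λ q<a → let r , q<r , r<a = <-dense q<a in r , q<r , r<a
  }

ℕ→ℝ : ℕ → ℝ
ℕ→ℝ n = ℚ→ℝ (ℕ→ℚ n)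

_+ᴿ_ : ℝ → ℝ → ℝ
x +ᴿ y = record
  { cut       = λ q → ∃₂ λ a b → cut x a × cut y b × q < a + b
  ; inhabited = let a , xa = inhabited x ; b , yb = inhabited y
                in  a + b - 1ℚ , a , b , xa , yb , q-1<q (a + b)
  ; bounded   = let u , x<u = bounded x ; v , y<v = bounded y
                in  u + v , λ (a , b , xa , yb , q<) → <-trans q< (+-mono-< (x<u xa) (y<v yb))
  ; downward  = λ q<r (a , b , xa , yb , r<) → a , b , xa , yb , <-trans q<r r<
  ; rounded   = λ (a , b , xa , yb , q<) → let r , q<r , r< = <-dense q<
                                           in  r , q<r , a , b , xa , yb , r<
  }

_·_ : (p : ℚ) .{{_ : NonNegative p}} → ℝ → ℝ
p · x = record
  { cut       = λ q → ∃[ a ] cut x a × q < p * a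
  ; inhabited = let a , xa = inhabited x in p * a - 1ℚ , a , xa , q-1<q (p * a)
  ; bounded   = let u , x<u = bounded x
                in  p * u , λ (a , xa , q<) → <-≤-trans q< (*-monoˡ-≤-nonNeg p (<⇒≤ (x<u xa)))
  ; downward  = λ q<r (a , xa , r<) → a , xa , <-trans q<r r<
  ; rounded   = λ (a , xa , q<) → let r , q<r , r< = <-dense q< in r , q<r , a , xa , r<
  }

-- q < log₂ a  iff  q < n/d for some integers n, d with d > 0 and 2ⁿ < aᵈ.
log⁺ : (a : ℚ) → 0ℚ < a → ℝ
log⁺ a 0<a = record
  { cut       = λ q → ∃₂ λ n d → q < n / suc d × pow2 n < a ^ suc d
  ; inhabited = let t , lt = ½^< a 0<a
                in  -[1+ t ] / 1 - 1ℚ , -[1+ t ] , 0 , q-1<q (-[1+ t ] / 1)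
                    , subst (½ ^ suc t <_) (sym (*-identityʳ a)) lt
  ; bounded   = ℕ→ℚ t , λ (n , d , q< , lt) → <-trans q< (≰⇒> (above n d lt))
  ; downward  = λ q<r (n , d , r< , lt) → n , d , <-trans q<r r< , lt
  ; rounded   = λ (n , d , q< , lt) → let r , q<r , r< = <-dense q< in r , q<r , n , d , r< , lt
  }
  where
  t : ℕ
  t = proj₁ (≤2^ a)
  above : ∀ n d → pow2 n < a ^ suc d → ¬ (ℕ→ℚ t ≤ n / suc d)
  above n d lt le = <-irrefl refl (begin-strict
    pow2 n                <⟨ lt ⟩
    a ^ suc d             ≤⟨ ^-monoˡ-≤ (<⇒≤ 0<a) (proj₂ (≤2^ a)) (suc d) ⟩
    (2ℚ ^ t) ^ suc d      ≡⟨ ^-assocʳ 2ℚ t (suc d) ⟩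
    2ℚ ^ (t ℕ.* suc d)    ≤⟨ ≤pow2 (clear-≥ n d t le) ⟩
    pow2 n                ∎)
    where open ≤-Reasoning

-- Base-2 logarithm, with the junk value 0 at arguments a ≤ 0.
log : ℚ → ℝ
log a with 0ℚ <? a
... | yes 0<a = log⁺ a 0<a
... | no  _   = ℚ→ℝ 0ℚ

-- q < 2ˣ  iff  q < s for some rational s ≥ 0 with sᵈ < 2ⁿ, where n/d < x.
exp₂ : ℝ → ℝ
exp₂ x = record
  { cut       = λ q → ∃₂ λ n d → ∃[ s ] cut x (n / suc d) × 0ℚ ≤ s × s ^ suc d < pow2 n × q < s
  ; inhabited = inh (inhabited x)
  ; bounded   = 2ℚ ^ t , λ (n , d , s , xr , 0≤s , lt , q<) →
                  <-trans q< (≰⇒> (above n d s xr 0≤s lt))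
  ; downward  = λ q<r (n , d , s , xr , 0≤s , lt , r<) → n , d , s , xr , 0≤s , lt , <-trans q<r r<
  ; rounded   = λ (n , d , s , xr , 0≤s , lt , q<) → let r , q<r , r< = <-dense q<
                  in r , q<r , n , d , s , xr , 0≤s , lt , r<
  }
  where
  inh : ∃ (cut x) → ∃[ q ] ∃₂ λ n d → ∃[ s ]
        cut x (n / suc d) × 0ℚ ≤ s × s ^ suc d < pow2 n × q < s
  inh (r , xr) = - 1ℚ , ↥ r , denominator-1 r , 0ℚ , subst (cut x) (sym (↥p/↧p≡p r)) xr
               , ≤-refl , 0^<pow2 (↥ r) (denominator-1 r) , negative⁻¹ (- 1ℚ)
    where open ℚ
  u : ℚ
  u = proj₁ (bounded x)
  t : ℕ
  t = proj₁ (archimedean u)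
  above : ∀ n d s → cut x (n / suc d) → 0ℚ ≤ s → s ^ suc d < pow2 n → ¬ (2ℚ ^ t ≤ s)
  above n d s xr 0≤s lt le = <-irrefl refl (begin-strict
    pow2 n                ≤⟨ pow2≤ (clear-≤ n d t (≤-trans (<⇒≤ (proj₂ (bounded x) xr))
                                                           (proj₂ (archimedean u)))) ⟩
    2ℚ ^ (t ℕ.* suc d)    ≡⟨ ^-assocʳ 2ℚ t (suc d) ⟨
    (2ℚ ^ t) ^ suc d      ≤⟨ ^-monoˡ-≤ (<⇒≤ (positive⁻¹ (2ℚ ^ t) {{^-pos 2ℚ t}})) le (suc d) ⟩
    s ^ suc d             <⟨ lt ⟩
    pow2 n                ∎)
    where open ≤-Reasoning

tower₂ : ℕ → ℝ → ℝ
tower₂ zero    x = x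
tower₂ (suc j) x = exp₂ (tower₂ j x)

------------------------------------------------------------------------
-- Random variables f(X) with X uniform on the entries of a nonempty list Ω.

module _ {A : Set} {m : ℕ} (Ω : List A) (f : A → Fin m) where

  range : List (Fin m)
  range = deduplicate Fin._≟_ (map f Ω)

  Pr : .{{_ : ℕ.NonZero (length Ω)}} → Fin m → ℚ
  Pr c = + length (filter (λ X → f X Fin.≟ c) Ω) / length Ω

-- p log (1/p), read as 0 when p = 0.
p·log[1/p] : ℚ → ℝ
p·log[1/p] p with 0ℚ <? p
... | no  _   = ℚ→ℝ 0ℚ
... | yes 0<p = p · log (1/ p)
  where
  instance
    _ = positive 0<p
    _ = pos⇒nonZero p
    _ = pos⇒nonNeg p

entropy : {A : Set} {m : ℕ} (Ω : List A) .{{_ : ℕ.NonZero (length Ω)}} → (A → Fin m) → ℝ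
entropy Ω f = foldr (λ c x → p·log[1/p] (Pr Ω f c) +ᴿ x) (ℚ→ℝ 0ℚ) (range Ω f)

------------------------------------------------------------------------
-- Subsets of size at most k

Subset≤ : ℕ → ℕ → Set
Subset≤ N k = Σ[ X ∈ Subset N ] ∣ X ∣ ℕ.≤ k

allSubsets : ∀ n → List (Subset n)
allSubsets zero    = [] ∷ []
allSubsets (suc n) = map (outside ∷_) (allSubsets n) ++ map (inside ∷_) (allSubsets n)

∈-allSubsets : ∀ {n} (X : Subset n) → X ∈ allSubsets n
∈-allSubsets []            = here refl
∈-allSubsets (outside ∷ X) = ∈-++⁺ˡ (∈-map⁺ (outside ∷_) (∈-allSubsets X))
∈-allSubsets {suc n} (inside ∷ X) =
  ∈-++⁺ʳ (map (outside ∷_) (allSubsets n)) (∈-map⁺ (inside ∷_) (∈-allSubsets X))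

-- All X ⊆ V, each paired with the proof that ∣ X ∣ ≤ ∣ V ∣ ≤ k.
subsetsOf : ∀ {N k} (V : Subset N) → ∣ V ∣ ℕ.≤ k → List (Subset≤ N k)
subsetsOf {N} {k} V ∣V∣≤k =
  All.reduce {P = _⊆ V} pair (all-filter (_⊆? V) (allSubsets N))
  where
  pair : ∀ {X} → X ⊆ V → Subset≤ N k
  pair {X} X⊆V = X , ℕ.≤-trans (p⊆q⇒∣p∣≤∣q∣ X⊆V) ∣V∣≤k

reduce-nonZero : ∀ {A B : Set} {P : A → Set} {f : ∀ {x} → P x → B} {x xs} →
                 x ∈ xs → (pxs : All P xs) → ℕ.NonZero (length (All.reduce f pxs))
reduce-nonZero x∈xs (_ ∷ _) = _

subsetsOf-nonZero : ∀ {N k} (V : Subset N) (∣V∣≤k : ∣ V ∣ ℕ.≤ k) →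
                    ℕ.NonZero (length (subsetsOf V ∣V∣≤k))
subsetsOf-nonZero {N} V _ = reduce-nonZero
  (∈-filter⁺ (_⊆? V) (∈-allSubsets ⊥) (⊥⊆ {p = V})) (all-filter (_⊆? V) (allSubsets N))

module _ {N k m : ℕ} (φ : Subset≤ N k → Fin m) (V : Subset N) (∣V∣≤k : ∣ V ∣ ℕ.≤ k) where

  #colours : ℕ
  #colours = length (range (subsetsOf V ∣V∣≤k) φ)

  -- The entropy of φ(X) for X a uniformly random subset of V.
  colourEntropy : ℝ
  colourEntropy = entropy (subsetsOf V ∣V∣≤k) {{subsetsOf-nonZero V ∣V∣≤k}} φ

{-# OPTIONS --safe #-}
-- A colouring φ is made end-homogeneous in the style of Erdős and Rado: elements are chosen one
-- after the other, each time shrinking the remaining ground set by pigeonhole so that, for every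
-- small set Y of chosen elements, Y ∪ {x} has the same colour for all remaining x.  On the chosen
-- elements φ(X) then depends only on X without its last element, so 2 ^ k colours become
-- 2 ^ (k ∸ 1) + 1.  Doing this i times, on ever smaller ground sets, leaves 2 ^ (k ∸ i) + i colours;
-- each round costs one exponential.
--
-- The entropy bound is Gibbs' inequality.  Lower cuts of the logarithms turn it into
-- n ^ n ≤ K ^ n * ∏ n_c ^ n_c for the K class sizes n_c, with sum n, which follows from AM-GM.
module Submission where

open import Data.Bool using (true; false)
open import Data.Empty using (⊥-elim)
open import Data.Fin using (Fin; zero; suc; toℕ)
import Data.Fin.Properties as Fin
open import Data.List using (List; []; _∷_; _++_; _ʳ++_; map; filter; foldr; length; replicate; reverse; take; allFin)
open import Data.List.Properties
  using (filter-some; length-++; length-map; length-replicate; length-reverse; length-tabulate; length-take; map-cong-local)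
open import Data.List.Membership.Propositional using (_∈_; lose)
open import Data.List.Membership.Propositional.Properties
  using (∈-++⁺ˡ; ∈-++⁺ʳ; ∈-++⁻; ∈-map⁺; ∈-map⁻; ∈-filter⁺; ∈-filter⁻; ∈-deduplicate⁺; ∈-deduplicate⁻; ∈-∃++)
open import Data.List.Relation.Binary.Sublist.Propositional as Sublist using (_∷ʳ_) renaming (_⊆_ to _⊑_)
import Data.List.Relation.Binary.Sublist.Propositional.Properties as Sublist
open import Data.List.Relation.Unary.All as All using (All; []; _∷_)
open import Data.List.Relation.Unary.All.Properties using (all-filter; All¬⇒¬Any)
open import Data.List.Relation.Unary.AllPairs using ([]; _∷_)
open import Data.List.Relation.Unary.Any using (here; there)
open import Data.List.Relation.Unary.Unique.DecPropositional.Properties using (deduplicate-!)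
open import Data.List.Relation.Unary.Unique.Propositional using (Unique)
open import Data.List.Relation.Unary.Unique.Propositional.Properties using (allFin⁺)
open import Data.Product using (Σ-syntax; ∃-syntax; ∃₂; _×_; _,_; proj₁; proj₂)
open import Data.Sum using (inj₁; inj₂)
open import Function using (_∘_; it)
open import Relation.Binary.PropositionalEquality
open import Relation.Nullary using (yes; no; does; ¬?; contradiction)
open import Relation.Unary using (Decidable)

open import Defs using (subsetsOf; subsetsOf-nonZero)

-- The last element `z` found by a round stays in the answer. It can replace the last element of
-- every nonempty set, so the next round colours `Y` by `g (z ∷ Y)` and looks for one element fewer.
-- Only the empty set has no last element; it supplies the one extra colour per round, hence the
-- `+ i`.
--
-- A round applies pigeonhole once for each small set of chosen elements, at every step, and each
-- application divides the ground set by `m`. Over the whole round the applications add up to a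
-- binomial sum in the number `M` of elements to be left, so the ground set has size `m` to a power
-- polynomial in `M`. As `M` is itself a tower, this polynomial has to be absorbed one level down;
-- the tower estimate therefore carries a factor `k * k` and some slack through all levels.
--
-- In the hypothesis on `N`, 2 to the power k + 2 log k is `2 ^ k * (k * k)`, which is what the
-- lowest level has to hold. Of the further 2, one unit pays for rounding 2 log k to an integer and
-- one for the strict inequality in the cut of `exp₂`.

-- Pigeonhole thinning and end-homogeneous lists

module EndHomogeneity where

  open import Data.Nat
  open import Data.Nat.Properties

  private variable
    A : Set

  length-filter-∁ : {P : A → Set} (P? : Decidable P) (xs : List A) →
                    length (filter P? xs) + length (filter (¬? ∘ P?) xs) ≡ length xs
  length-filter-∁ P? []       = refl
  length-filter-∁ P? (x ∷ xs) with does (P? x)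
  ... | true  = cong suc (length-filter-∁ P? xs)
  ... | false = trans (+-suc _ _) (cong suc (length-filter-∁ P? xs))

  -- Induction on the number of values: if the class of the largest value has at most `t` entries,
  -- discarding it leaves more than `t * m`. Values are natural numbers here so that lowering the
  -- bound does not change their type.
  pigeonhole-ℕ : ∀ m (h : A → ℕ) t (xs : List A) → All (λ x → h x < m) xs → t * m < length xs →
               ∃[ c ] t < length (filter (λ x → h x ≟ c) xs)
  pigeonhole-ℕ zero    h t (x ∷ xs) (() ∷ _) _
  pigeonhole-ℕ zero    h t []       _        ()
  pigeonhole-ℕ (suc m) h t xs       h<1+m    t*[1+m]<
    with t <? length (filter (λ x → h x ≟ m) xs)
  ... | yes t<  = m , t<
  ... | no  t≮  = let c , t<c = pigeonhole-ℕ m h t rest rest<m t*m<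
                  in  c , <-≤-trans t<c (shorter c)
    where
    rest = filter (λ x → ¬? (h x ≟ m)) xs
    rest⊑ : rest ⊑ xs
    rest⊑ = Sublist.filter-⊆ (λ x → ¬? (h x ≟ m)) xs
    rest<m : All (λ x → h x < m) rest
    rest<m = All.zipWith (λ { (s≤s h≤m , h≢m) → ≤∧≢⇒< h≤m h≢m })
               (Sublist.All-resp-⊆ rest⊑ h<1+m , all-filter (λ x → ¬? (h x ≟ m)) xs)
    shorter : ∀ c → length (filter (λ x → h x ≟ c) rest) ≤ length (filter (λ x → h x ≟ c) xs)
    shorter c = Sublist.length-mono-≤ (Sublist.filter⁺ (λ x → h x ≟ c) (λ x → h x ≟ c) (λ { refl p → p }) rest⊑)
    t*m< : t * m < length rest
    t*m< = +-cancelˡ-< t (t * m) (length rest) (begin-strict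
      t + t * m                                                      ≡⟨ *-suc t m ⟨
      t * suc m                                                      <⟨ t*[1+m]< ⟩
      length xs                                                      ≡⟨ length-filter-∁ (λ x → h x ≟ m) xs ⟨
      length (filter (λ x → h x ≟ m) xs) + length rest               ≤⟨ +-monoˡ-≤ _ (≮⇒≥ t≮) ⟩
      t + length rest                                                ∎)
      where open ≤-Reasoning

  Const : {m : ℕ} → (A → Fin m) → List A → Set
  Const h xs = ∀ {x y} → x ∈ xs → y ∈ xs → h x ≡ h y

  pigeonhole : ∀ {m} (h : A → Fin m) t (xs : List A) → t * m < length xs →
               ∃[ ys ] ys ⊑ xs × t < length ys × Const h ys
  pigeonhole h t xs t*m<
    with c , t<ys ← pigeonhole-ℕ _ (toℕ ∘ h) t xs (All.tabulate (λ {x} _ → Fin.toℕ<n (h x))) t*m<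
    = filter (λ x → toℕ (h x) ≟ c) xs , Sublist.filter-⊆ (λ x → toℕ (h x) ≟ c) xs , t<ys
    , λ x∈ y∈ → Fin.toℕ-injective (trans (All.lookup all x∈) (sym (All.lookup all y∈)))
    where all = all-filter (λ x → toℕ (h x) ≟ c) xs

  Const-⊑ : ∀ {m} {h : A → Fin m} {xs ys} → ys ⊑ xs → Const h xs → Const h ys
  Const-⊑ ys⊑xs const x∈ y∈ = const (Sublist.lookup ys⊑xs x∈) (Sublist.lookup ys⊑xs y∈)

  -- Each colouring costs one factor `m`, and constancy already achieved survives further thinning
  -- because it passes to sublists.
  pigeonhole* : ∀ {m} (hs : List (A → Fin m)) t (xs : List A) → t * m ^ length hs < length xs →
                ∃[ ys ] ys ⊑ xs × t < length ys × All (λ h → Const h ys) hs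
  pigeonhole* []       t xs t<  = xs , Sublist.⊆-refl , subst (_< length xs) (*-identityʳ t) t< , []
  pigeonhole* {m = m} (h ∷ hs) t xs lt
    with ys , ys⊑xs , t*m< , consts ← pigeonhole* hs (t * m) xs
           (subst (_< length xs) (sym (*-assoc t m (m ^ length hs))) lt)
    with zs , zs⊑ys , t< , const ← pigeonhole h t ys t*m<
    = zs , Sublist.⊆-trans zs⊑ys ys⊑xs , t<
    , (λ {x} {y} → const {x} {y}) ∷ All.map (λ {g} → Const-⊑ {h = g} zs⊑ys) consts

  sublists≤ : ℕ → List A → List (List A)
  sublists≤ r       []       = [] ∷ []
  sublists≤ zero    (x ∷ xs) = [] ∷ []
  sublists≤ (suc r) (x ∷ xs) = sublists≤ (suc r) xs ++ map (x ∷_) (sublists≤ r xs)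

  -- The binomial sum C(n,0) + ... + C(n,r), by Pascal's rule.
  #sublists≤ : ℕ → ℕ → ℕ
  #sublists≤ r       zero    = 1
  #sublists≤ zero    (suc n) = 1
  #sublists≤ (suc r) (suc n) = #sublists≤ (suc r) n + #sublists≤ r n

  length-sublists≤ : ∀ r (xs : List A) → length (sublists≤ r xs) ≡ #sublists≤ r (length xs)
  length-sublists≤ r       []       = refl
  length-sublists≤ zero    (x ∷ xs) = refl
  length-sublists≤ (suc r) (x ∷ xs) = begin
    length (sublists≤ (suc r) xs ++ map (x ∷_) (sublists≤ r xs))          ≡⟨ length-++ (sublists≤ (suc r) xs) ⟩
    length (sublists≤ (suc r) xs) + length (map (x ∷_) (sublists≤ r xs))  ≡⟨ cong₂ _+_ (length-sublists≤ (suc r) xs) length-map-∷ ⟩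
    #sublists≤ (suc r) (length xs) + #sublists≤ r (length xs)             ∎
    where
    open ≡-Reasoning
    length-map-∷ : length (map (x ∷_) (sublists≤ r xs)) ≡ #sublists≤ r (length xs)
    length-map-∷ = trans (length-map (x ∷_) (sublists≤ r xs)) (length-sublists≤ r xs)

  ∈-sublists≤ : ∀ {r} {xs ys : List A} → ys ⊑ xs → length ys ≤ r → ys ∈ sublists≤ r xs
  ∈-sublists≤ {r = r}     Sublist.[]          _         = here refl
  ∈-sublists≤ {r = zero}  {ys = []} (x ∷ʳ ys⊑) _        = here refl
  ∈-sublists≤ {r = suc r} (x ∷ʳ ys⊑)          ≤r        = ∈-++⁺ˡ (∈-sublists≤ ys⊑ ≤r)
  ∈-sublists≤ {r = suc r} {xs = x ∷ xs} (refl Sublist.∷ ys⊑) (s≤s ≤r) =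
    ∈-++⁺ʳ (sublists≤ (suc r) xs) (∈-map⁺ (x ∷_) (∈-sublists≤ ys⊑ ≤r))

  0<#sublists≤ : ∀ r n → 0 < #sublists≤ r n
  0<#sublists≤ r       zero    = s≤s z≤n
  0<#sublists≤ zero    (suc n) = s≤s z≤n
  0<#sublists≤ (suc r) (suc n) = ≤-trans (0<#sublists≤ (suc r) n) (m≤m+n _ _)

  #sublists≤≤2^ : ∀ r n → #sublists≤ r n ≤ 2 ^ n
  #sublists≤≤2^ r       zero    = ≤-refl
  #sublists≤≤2^ zero    (suc n) = m^n>0 2 (suc n)
  #sublists≤≤2^ (suc r) (suc n) = +-mono-≤ (#sublists≤≤2^ (suc r) n)
    (≤-trans (#sublists≤≤2^ r n) (≤-reflexive (sym (+-identityʳ (2 ^ n)))))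

  -- Above the lowest level `n` is as large as a tower, and the bound `2 ^ n` would cost a second
  -- exponential per round; this one is polynomial in `n` for fixed `r`.
  #sublists≤≤^ : ∀ r n → #sublists≤ r n ≤ suc n ^ r
  #sublists≤≤^ r       zero    = m^n>0 1 r
  #sublists≤≤^ zero    (suc n) = ≤-refl
  #sublists≤≤^ (suc r) (suc n) = begin
    #sublists≤ (suc r) n + #sublists≤ r n   ≤⟨ +-mono-≤ (#sublists≤≤^ (suc r) n) (#sublists≤≤^ r n) ⟩
    suc n * suc n ^ r + suc n ^ r           ≡⟨ +-comm (suc n * suc n ^ r) (suc n ^ r) ⟩
    suc (suc n) * suc n ^ r                 ≤⟨ *-monoʳ-≤ (suc (suc n)) (^-monoˡ-≤ r (n≤1+n (suc n))) ⟩
    suc (suc n) * suc (suc n) ^ r           ∎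
    where open ≤-Reasoning

  -- Lists are read from the last chosen element to the first: x ∷ Y is Y with a new last element x.
  EndHomogeneous : ∀ {m} → (List A → Fin m) → ℕ → A → List A → Set
  EndHomogeneous g r z P = ∀ {x Y} → x ∷ Y ⊑ P → length Y ≤ r → g (x ∷ Y) ≡ g (z ∷ Y)

  -- The number of pigeonhole applications while `j` elements join `p` chosen ones: at each step,
  -- one for every set of at most `r` elements chosen so far.
  cost : ℕ → ℕ → ℕ → ℕ
  cost r p zero    = 0
  cost r p (suc j) = #sublists≤ r p + cost r (suc p) j

  -- The hockey-stick identity: each step's cost is the increment that Pascal's rule gives to the
  -- binomial sum of order `suc r`.
  #sublists≤+cost : ∀ r p j → #sublists≤ (suc r) p + cost r p j ≡ #sublists≤ (suc r) (j + p)
  #sublists≤+cost r p zero    = +-identityʳ _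
  #sublists≤+cost r p (suc j) = begin
    #sublists≤ (suc r) p + (#sublists≤ r p + cost r (suc p) j)  ≡⟨ +-assoc (#sublists≤ (suc r) p) _ _ ⟨
    #sublists≤ (suc r) (suc p) + cost r (suc p) j               ≡⟨ #sublists≤+cost r (suc p) j ⟩
    #sublists≤ (suc r) (j + suc p)                              ≡⟨ cong (#sublists≤ (suc r)) (+-suc j p) ⟩
    #sublists≤ (suc r) (suc j + p)                              ∎
    where open ≡-Reasoning

  -- `P` holds the chosen elements, `L` the remaining ones. A step thins `L` until `g (x ∷ Y)` does
  -- not depend on `x` for any small `Y ⊑ P`, then moves the head `w` to `P`. Every later `z` comes
  -- from the same thinned list as `w`, whence `g (w ∷ Y) ≡ g (z ∷ Y)`. The size condition is on
  -- `suc (length L)` so that moving `w` out of the list is already paid for.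
  extend : ∀ {m} → 2 ≤ m → (g : List A → Fin m) (r : ℕ) (L₀ : List A) (j : ℕ) (P L : List A) →
           P ʳ++ L ⊑ L₀ → m ^ suc (cost r (length P) j) ≤ suc (length L) →
           (∀ {z} → z ∈ L → EndHomogeneous g r z P) →
           ∃₂ λ z P′ → length P′ ≡ j + length P × reverse (z ∷ P′) ⊑ L₀ × EndHomogeneous g r z P′
  extend {m = m} 2≤m g r L₀ zero P [] P⊑ lt hom = ⊥-elim (<-irrefl refl (≤-trans 2≤m (≤-trans (≤-reflexive (sym (*-identityʳ m))) lt)))
  extend 2≤m g r L₀ zero P (z ∷ L) P⊑ lt hom = z , P , refl
    , Sublist.⊆-trans (Sublist.ʳ++⁺ (Sublist.⊆-refl {x = z ∷ P}) (Sublist.minimum L)) P⊑ , hom (here refl)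
  extend {A = A} {m = m} 2≤m g r L₀ (suc j) P L P⊑ lt hom = go (pigeonhole* hs (X ∸ 1) L refine-bound)
    where
    hs : List (A → Fin m)
    hs = map (λ Y x → g (x ∷ Y)) (sublists≤ r P)
    c X : ℕ
    c = #sublists≤ r (length P)
    X = m ^ suc (cost r (suc (length P)) j)
    instance
      m≢0 : NonZero m
      m≢0 = >-nonZero (≤-trans (s≤s z≤n) 2≤m)
    length-hs : length hs ≡ c
    length-hs = trans (length-map _ (sublists≤ r P)) (length-sublists≤ r P)
    1<m^c : 1 < m ^ c
    1<m^c = ≤-trans 2≤m (≤-trans (≤-reflexive (sym (*-identityʳ m))) (^-monoʳ-≤ m (0<#sublists≤ r (length P))))
    X>0 : 0 < X
    X>0 = m^n>0 m (suc (cost r (suc (length P)) j))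
    sucX-1 : suc (X ∸ 1) ≡ X
    sucX-1 = m+[n∸m]≡n X>0
    -- Asking for more than `X ∸ 1` entries instead of more than `X` frees `m ^ c`, which is at
    -- least 2; that covers both the strict inequality and the `suc` on the right.
    refine-bound : (X ∸ 1) * m ^ length hs < length L
    refine-bound = ≤-pred (begin
      suc (suc ((X ∸ 1) * m ^ length hs))     ≡⟨ cong (λ n → suc (suc ((X ∸ 1) * m ^ n))) length-hs ⟩
      2 + (X ∸ 1) * m ^ c                     ≤⟨ +-monoˡ-≤ ((X ∸ 1) * m ^ c) 1<m^c ⟩
      suc (X ∸ 1) * m ^ c                     ≡⟨ cong (_* m ^ c) sucX-1 ⟩
      X * m ^ c                               ≡⟨ ^-distribˡ-+-* m (suc (cost r (suc (length P)) j)) c ⟨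
      m ^ (suc (cost r (suc (length P)) j) + c)  ≡⟨ cong (m ^_) (cong suc (+-comm _ c)) ⟩
      m ^ suc (cost r (length P) (suc j))     ≤⟨ lt ⟩
      suc (length L)                          ∎)
      where open ≤-Reasoning
    hom-∷ : ∀ {w L₁} → w ∷ L₁ ⊑ L → All (λ h → Const h (w ∷ L₁)) hs →
            ∀ {z} → z ∈ L₁ → EndHomogeneous g r z (w ∷ P)
    hom-∷ wL₁⊑L _ z∈ (_ ∷ʳ xY⊑P)             ≤r = hom (Sublist.lookup wL₁⊑L (there z∈)) xY⊑P ≤r
    hom-∷ _ consts z∈ (refl Sublist.∷ Y⊑P) ≤r =
      All.lookup consts (∈-map⁺ (λ Y x → g (x ∷ Y)) (∈-sublists≤ Y⊑P ≤r)) (here refl) (there z∈)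
    go : (∃[ L₁ ] L₁ ⊑ L × X ∸ 1 < length L₁ × All (λ h → Const h L₁) hs) →
         ∃₂ λ z P′ → length P′ ≡ suc j + length P × reverse (z ∷ P′) ⊑ L₀ × EndHomogeneous g r z P′
    go ([]     , _    , ()     , _)
    go (w ∷ L₁ , L₁⊑L , X-1<L₁ , consts)
      with z , P′ , eq , P′⊑ , hom′ ← extend 2≤m g r L₀ j (w ∷ P) L₁
        (Sublist.⊆-trans (Sublist.ʳ++⁺ (Sublist.⊆-refl {x = P}) L₁⊑L) P⊑)
        (subst (_≤ suc (length L₁)) sucX-1 X-1<L₁)
        (hom-∷ L₁⊑L consts)
      = z , P′ , trans eq (+-suc j (length P)) , P′⊑ , hom′

  erdős-rado : ∀ {m} → 2 ≤ m → (g : List A → Fin m) (r M : ℕ) (L : List A) →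
               m ^ #sublists≤ (suc r) M ≤ suc (length L) →
               ∃₂ λ z P → length P ≡ M × z ∷ P ⊑ L × EndHomogeneous g r z P
  erdős-rado {m = m} 2≤m g r M L lt
    -- Choosing from `reverse L` makes the last chosen element the head of a sublist of `L`. The
    -- `suc` in the exponent is `#sublists≤ (suc r) 0`, which completes the telescoping sum.
    with z , P , eq , P⊑ , hom ← extend 2≤m g r (reverse L) M [] (reverse L) Sublist.⊆-refl
      (subst₂ (λ e l → m ^ e ≤ suc l)
        (trans (cong (#sublists≤ (suc r)) (sym (+-identityʳ M))) (sym (#sublists≤+cost r 0 M)))
        (sym (length-reverse L)) lt) (λ _ → λ ())
    = z , P , trans eq (+-identityʳ M) , Sublist.reverse⁻ P⊑ , hom

  -- To find `suc n` elements, a round must leave enough of them for the other `i` rounds to find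
  -- `n`; its own last element is the missing one.
  ramseyBound : ℕ → ℕ → ℕ → ℕ
  ramseyBound m zero    n       = n
  ramseyBound m (suc i) zero    = 0
  ramseyBound m (suc i) (suc n) = m ^ #sublists≤ (suc n) (ramseyBound m i n)

  fewColours : ∀ {m} → 2 ≤ m → (i n : ℕ) → i ≤ n → (g : List A → Fin m) (L : List A) → ramseyBound m i n ≤ length L →
               ∃₂ λ V C → length V ≡ n × V ⊑ L × length C ≤ 2 ^ (n ∸ i) + i × (∀ {X} → X ⊑ V → g X ∈ C)
  fewColours 2≤m zero n _ g L n≤ = V , map g (sublists≤ n V) , length-V , Sublist.take-⊆ n L
    , (begin
        length (map g (sublists≤ n V))  ≡⟨ length-map g (sublists≤ n V) ⟩
        length (sublists≤ n V)          ≡⟨ length-sublists≤ n V ⟩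
        #sublists≤ n (length V)         ≤⟨ #sublists≤≤2^ n (length V) ⟩
        2 ^ length V                    ≡⟨ cong (2 ^_) length-V ⟩
        2 ^ n                           ≡⟨ +-identityʳ (2 ^ n) ⟨
        2 ^ n + 0                       ∎)
    , λ X⊑V → ∈-map⁺ g (∈-sublists≤ X⊑V (≤-trans (Sublist.length-mono-≤ X⊑V) (≤-reflexive length-V)))
    where
    open ≤-Reasoning
    V = take n L
    length-V : length V ≡ n
    length-V = trans (length-take n L) (m≤n⇒m⊓n≡m n≤)
  fewColours {m = m} 2≤m (suc i) (suc n) (s≤s i≤n) g L bound
    with z , P , length-P , zP⊑L , hom ← erdős-rado 2≤m g n (ramseyBound m i n) L (m≤n⇒m≤1+n bound)
    with V , C , length-V , V⊑P , length-C , g∈C ← fewColours 2≤m i n i≤n (λ Y → g (z ∷ Y)) P (≤-reflexive (sym length-P))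
    = z ∷ V , g [] ∷ C , cong suc length-V , Sublist.⊆-trans (refl Sublist.∷ V⊑P) zP⊑L
    , ≤-trans (s≤s length-C) (≤-reflexive (sym (+-suc (2 ^ (n ∸ i)) i)))
    , λ { {[]}    _                  → here refl
        -- A nonempty list that avoids `z`: end-homogeneity replaces its head by `z`, and the tail
        -- is still a sublist of `V`.
        ; {x ∷ Y} (.z ∷ʳ xY⊑V)       → there (subst (_∈ C)
            (sym (hom (Sublist.⊆-trans xY⊑V V⊑P) (≤-trans (≤-trans (n≤1+n _) (Sublist.length-mono-≤ xY⊑V)) (≤-reflexive length-V))))
            (g∈C (Sublist.⊆-trans (x ∷ʳ Sublist.⊆-refl) xY⊑V)))
        ; {x ∷ Y} (refl Sublist.∷ Y⊑V) → there (g∈C Y⊑V) }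

-- Comparison of the pigeonhole bound with a tower of twos

module TowerBound where

  open import Data.Nat
  open import Data.Nat.Properties
  open import Data.Nat.Tactic.RingSolver using (solve-∀)
  open EndHomogeneity using (#sublists≤; 0<#sublists≤; #sublists≤≤2^; #sublists≤≤^; ramseyBound)

  n<2^n : ∀ n → n < 2 ^ n
  n<2^n zero    = s≤s z≤n
  n<2^n (suc n) = begin
    suc (suc n)      ≤⟨ s≤s (n<2^n n) ⟩
    1 + 2 ^ n        ≤⟨ +-monoˡ-≤ (2 ^ n) (m^n>0 2 n) ⟩
    2 ^ n + 2 ^ n    ≡⟨ cong (2 ^ n +_) (+-identityʳ (2 ^ n)) ⟨
    2 ^ suc n        ∎
    where open ≤-Reasoning

  -- For `n = k * k` this rounds 2 log k down to an integer `l`, with an error of at most 1. The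
  -- left inequality is strict because the cut of `log` asks for a strict one.
  2^<≤2^1+ : ∀ n → 2 ≤ n → ∃[ l ] 2 ^ l < n × n ≤ 2 ^ suc l
  2^<≤2^1+ (suc zero) (s≤s ())
  2^<≤2^1+ (suc (suc zero))    _ = 0 , ≤-refl , ≤-refl
  2^<≤2^1+ (suc (suc (suc n))) _ with 2^<≤2^1+ (suc (suc n)) (s≤s (s≤s z≤n))
  ... | l , 2^l< , ≤2^1+l with 3 + n ≤? 2 ^ suc l
  ... | yes ≤ = l , m≤n⇒m≤1+n 2^l< , ≤
  ... | no  ≰ = suc l , ≰⇒> ≰
    , (begin
        suc (2 + n)               ≤⟨ s≤s ≤2^1+l ⟩
        1 + 2 ^ suc l             ≤⟨ +-monoˡ-≤ (2 ^ suc l) (m^n>0 2 (suc l)) ⟩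
        2 ^ suc l + 2 ^ suc l     ≡⟨ cong (2 ^ suc l +_) (+-identityʳ _) ⟨
        2 ^ suc (suc l)           ∎)
    where open ≤-Reasoning

  -- From a ≤ x, the cut of exp₂ x yields 2 ^ (a ∸ 1) with the integral exponent a ∸ 1 < x; the bounds
  -- below have room for this loss at each level.
  weakTower : ℕ → ℕ → ℕ
  weakTower zero    a = a
  weakTower (suc j) a = 2 ^ pred (weakTower j a)

  0<weakTower : ∀ j {a} → 0 < a → 0 < weakTower j a
  0<weakTower zero    0<a = 0<a
  0<weakTower (suc j) {a} 0<a = m^n>0 2 (pred (weakTower j a))

  -- With `Y = 2 ^ (Z + k)`, the term `3 * k + 1` is at most `Y`, and `k * k * Y + Y` is at most
  -- `Y * (2 ^ k * 2 ^ k)` since `k < 2 ^ k`. So `2 * k` more in the exponent absorb both the factor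
  -- and the slack.
  exponential-dominates : ∀ k Z → 2 ≤ Z → k * k * 2 ^ (Z + k) + (3 * k + 1) ≤ 2 ^ (Z + 3 * k)
  exponential-dominates k Z 2≤Z = begin
    k * k * Y + (3 * k + 1)            ≤⟨ +-mono-≤ (*-monoˡ-≤ Y (*-mono-≤ (≤-pred (≤-trans (n<2^n k) (n≤1+n _))) (≤-refl {k}))) Y-bound ⟩
    2 ^ k * k * Y + Y                  ≤⟨ +-monoʳ-≤ (2 ^ k * k * Y) (m≤n*m Y (2 ^ k) {{m^n≢0 2 k}}) ⟩
    2 ^ k * k * Y + 2 ^ k * Y          ≡⟨ arrange (2 ^ k) k Y ⟩
    Y * (2 ^ k * suc k)                ≤⟨ *-monoʳ-≤ Y (*-monoʳ-≤ (2 ^ k) (n<2^n k)) ⟩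
    Y * (2 ^ k * 2 ^ k)                ≡⟨ cong (Y *_) (^-distribˡ-+-* 2 k k) ⟨
    Y * 2 ^ (k + k)                    ≡⟨ ^-distribˡ-+-* 2 (Z + k) (k + k) ⟨
    2 ^ (Z + k + (k + k))              ≡⟨ cong (2 ^_) (exponent Z k) ⟩
    2 ^ (Z + 3 * k)                    ∎
    where
    open ≤-Reasoning
    Y = 2 ^ (Z + k)
    arrange : ∀ a k Y → a * k * Y + a * Y ≡ Y * (a * suc k)
    arrange = solve-∀
    exponent : ∀ Z k → Z + k + (k + k) ≡ Z + 3 * k
    exponent = solve-∀
    Y-bound : 3 * k + 1 ≤ Y
    Y-bound = begin
      3 * k + 1              ≤⟨ m≤m+n _ (k + 3) ⟩
      3 * k + 1 + (k + 3)    ≡⟨ four k ⟩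
      4 * suc k              ≤⟨ *-mono-≤ (^-monoʳ-≤ 2 2≤Z) (n<2^n k) ⟩
      2 ^ Z * 2 ^ k          ≡⟨ ^-distribˡ-+-* 2 Z k ⟨
      Y                      ∎
      where
      four : ∀ k → 3 * k + 1 + (k + 3) ≡ 4 * suc k
      four = solve-∀

  module _ {k m l : ℕ} (2≤k : 2 ≤ k) (m≤2^k : m ≤ 2 ^ k) (k²≤2^1+l : k * k ≤ 2 ^ suc l) where

    private
      tower : ℕ → ℕ
      tower j = weakTower j (k + l + 2)

    tower-1 : 2 ^ k * (k * k) ≤ tower 1
    tower-1 = begin
      2 ^ k * (k * k)     ≤⟨ *-monoʳ-≤ (2 ^ k) k²≤2^1+l ⟩
      2 ^ k * 2 ^ suc l   ≡⟨ ^-distribˡ-+-* 2 k (suc l) ⟨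
      2 ^ (k + suc l)     ≡⟨ cong (λ n → 2 ^ pred n) (exponent k l) ⟩
      tower 1             ∎
      where
      open ≤-Reasoning
      exponent : ∀ k l → suc (k + suc l) ≡ k + l + 2
      exponent = solve-∀

    m^≤2^ : ∀ S → m ^ S ≤ 2 ^ (k * S)
    m^≤2^ S = ≤-trans (^-monoˡ-≤ S m≤2^k) (≤-reflexive (^-*-assoc 2 k S))

    k≤k² : k ≤ k * k
    k≤k² = m≤m*n k k {{>-nonZero (≤-trans (s≤s z≤n) 2≤k)}}

    -- The invariant behind the tower bound. In the factor `k * k`, one `k` comes from `m ≤ 2 ^ k`
    -- and one from sets of size at most `k`. Of the slack, 1 pays for the `pred` in `weakTower`,
    -- `k` for the `suc` in `suc (m ^ S) ^ k`, and `2 * k` for restoring factor and slack on the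
    -- next level.
    #sublists≤-tower : ∀ i n → i ≤ n → n < k →
      k * k * #sublists≤ (suc n) (ramseyBound m i n) + (3 * k + 1) ≤ tower (suc i)
    #sublists≤-tower zero n _ (s≤s {n = k′} n≤k′) = begin
      k * k * #sublists≤ (suc n) n + (3 * k + 1)   ≤⟨ +-mono-≤ (*-monoʳ-≤ (k * k) S≤H) small ⟩
      k * k * H + k * k * H                        ≡⟨ double (k * k) H ⟩
      2 ^ k * (k * k)                              ≤⟨ tower-1 ⟩
      tower 1                                      ∎
      where
      open ≤-Reasoning
      -- Half of `2 ^ k`: one half of `2 ^ k * (k * k)` bounds the main term, the other half the
      -- slack.
      H = 2 ^ k′
      S≤H : #sublists≤ (suc n) n ≤ H
      S≤H = ≤-trans (#sublists≤≤2^ (suc n) n) (^-monoʳ-≤ 2 n≤k′)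
      double : ∀ a H → a * H + a * H ≡ 2 * H * a
      double = solve-∀
      split : ∀ k → 3 * k + k ≡ k * 2 * 2
      split = solve-∀
      small : 3 * k + 1 ≤ k * k * H
      small = begin
        3 * k + 1     ≤⟨ +-monoʳ-≤ (3 * k) (s≤s z≤n) ⟩
        3 * k + k     ≡⟨ split k ⟩
        k * 2 * 2     ≤⟨ *-mono-≤ (*-monoʳ-≤ k 2≤k) (^-monoʳ-≤ 2 {1} (≤-pred 2≤k)) ⟩
        k * k * H     ∎
    #sublists≤-tower (suc i) (suc n) (s≤s i≤n) 1+n<k = begin
      k * k * #sublists≤ (suc (suc n)) (m ^ S) + (3 * k + 1)
        ≤⟨ +-monoˡ-≤ (3 * k + 1) (*-monoʳ-≤ (k * k) bound) ⟩
      k * k * 2 ^ (Z + k) + (3 * k + 1)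
        ≤⟨ exponential-dominates k Z 2≤Z ⟩
      2 ^ (Z + 3 * k)
        ≤⟨ ^-monoʳ-≤ 2 (≤-trans (≤-reflexive (cong pred (1+ Z k))) (pred-mono-≤ (#sublists≤-tower i n i≤n (<-trans (n<1+n n) 1+n<k)))) ⟩
      tower (suc (suc i)) ∎
      where
      open ≤-Reasoning
      S = #sublists≤ (suc n) (ramseyBound m i n)
      Z = k * k * S
      1+ : ∀ Z k → suc (Z + 3 * k) ≡ Z + (3 * k + 1)
      1+ = solve-∀
      2≤Z : 2 ≤ Z
      2≤Z = *-mono-≤ (≤-trans 2≤k k≤k²) (0<#sublists≤ (suc n) (ramseyBound m i n))
      exponent : ∀ k S → (1 + k * S) * k ≡ k * k * S + k
      exponent = solve-∀
      bound : #sublists≤ (suc (suc n)) (m ^ S) ≤ 2 ^ (Z + k)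
      bound = begin
        #sublists≤ (suc (suc n)) (m ^ S)   ≤⟨ #sublists≤≤^ (suc (suc n)) (m ^ S) ⟩
        suc (m ^ S) ^ suc (suc n)          ≤⟨ ^-monoʳ-≤ (suc (m ^ S)) 1+n<k ⟩
        suc (m ^ S) ^ k                    ≤⟨ ^-monoˡ-≤ k (s≤s (m^≤2^ S)) ⟩
        (1 + 2 ^ (k * S)) ^ k              ≤⟨ ^-monoˡ-≤ k (+-mono-≤ (m^n>0 2 (k * S)) (m≤m+n (2 ^ (k * S)) 0)) ⟩
        (2 ^ (1 + k * S)) ^ k              ≡⟨ ^-*-assoc 2 (1 + k * S) k ⟩
        2 ^ ((1 + k * S) * k)              ≡⟨ cong (2 ^_) (exponent k S) ⟩
        2 ^ (Z + k)                        ∎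

    ramseyBound≤weakTower : ∀ i → i ≤ k → ramseyBound m i k ≤ weakTower (suc i) (k + l + 2)
    ramseyBound≤weakTower zero    _ = begin
      k                  ≤⟨ k≤k² ⟩
      k * k              ≤⟨ m≤n*m (k * k) (2 ^ k) {{m^n≢0 2 k}} ⟩
      2 ^ k * (k * k)    ≤⟨ tower-1 ⟩
      tower 1            ∎
      where open ≤-Reasoning
    ramseyBound≤weakTower (suc i) (s≤s {n = n} i≤n) = begin
      m ^ S                                   ≤⟨ m^≤2^ S ⟩
      2 ^ (k * S)                             ≤⟨ ^-monoʳ-≤ 2 (*-monoˡ-≤ S k≤k²) ⟩
      2 ^ (k * k * S)                         ≤⟨ ^-monoʳ-≤ 2 (pred-mono-≤ (≤-trans 1+Z≤ (#sublists≤-tower i n i≤n ≤-refl))) ⟩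
      tower (suc (suc i))                     ∎
      where
      open ≤-Reasoning
      S = #sublists≤ (suc n) (ramseyBound m i n)
      1+Z≤ : 1 + k * k * S ≤ k * k * S + (3 * k + 1)
      1+Z≤ = ≤-trans (≤-reflexive (+-comm 1 (k * k * S))) (+-monoʳ-≤ (k * k * S) (m≤n+m 1 (3 * k)))

-- Passing between subsets and lists without repetition

module SubsetsAsLists where

  open import Data.Fin.Subset using (Subset; inside; outside; ∣_∣; ⁅_⁆; _∪_; ⊥)
    renaming (_∈_ to _∈ˢ_; _∉_ to _∉ˢ_; _⊆_ to _⊆ˢ_)
  open import Data.Fin.Subset.Properties
    using (∪-identityˡ; x∈p∪q⁻; x∈p∪q⁺; x∈⁅x⁆; x∈⁅y⁆⇒x≡y; ∣⊥∣≡0; ∉⊥; ⊆-antisym) renaming (_∈?_ to _∈ˢ?_)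
  open import Data.Nat
  open import Data.Nat.Properties
  open import Data.Vec using (_∷_; here; there)
  open import Defs using (Subset≤; allSubsets; #colours)
  open EndHomogeneity using (ramseyBound; fewColours)

  Unique-⊑ : {A : Set} {xs ys : List A} → xs ⊑ ys → Unique ys → Unique xs
  Unique-⊑ Sublist.[]           []         = []
  Unique-⊑ (y ∷ʳ xs⊑)           (_ ∷ ys!)  = Unique-⊑ xs⊑ ys!
  Unique-⊑ (refl Sublist.∷ xs⊑) (y∉ ∷ ys!) = Sublist.All-resp-⊆ xs⊑ y∉ ∷ Unique-⊑ xs⊑ ys!

  Unique-length-≤ : {A : Set} {xs ys : List A} → Unique xs → (∀ {x} → x ∈ xs → x ∈ ys) → length xs ≤ length ys
  Unique-length-≤ []                  _     = z≤n
  Unique-length-≤ {xs = x ∷ xs} (x∉ ∷ xs!) xs⊆ys with ys₁ , ys₂ , refl ← ∈-∃++ (xs⊆ys (here refl)) = begin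
    suc (length xs)                 ≤⟨ s≤s (Unique-length-≤ xs! (λ y∈ → remove (xs⊆ys (there y∈)) λ { refl → All¬⇒¬Any x∉ y∈ })) ⟩
    suc (length (ys₁ ++ ys₂))       ≡⟨ cong suc (length-++ ys₁) ⟩
    suc (length ys₁ + length ys₂)   ≡⟨ +-suc (length ys₁) (length ys₂) ⟨
    length ys₁ + suc (length ys₂)   ≡⟨ length-++ ys₁ ⟨
    length (ys₁ ++ x ∷ ys₂)         ∎
    where
    open ≤-Reasoning
    remove : ∀ {y} → y ∈ ys₁ ++ x ∷ ys₂ → y ≢ x → y ∈ ys₁ ++ ys₂
    remove y∈ y≢x with ∈-++⁻ ys₁ y∈
    ... | inj₁ y∈ys₁         = ∈-++⁺ˡ y∈ys₁
    ... | inj₂ (here y≡x)    = contradiction y≡x y≢x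
    ... | inj₂ (there y∈ys₂) = ∈-++⁺ʳ ys₁ y∈ys₂

  toSubset : ∀ {N} → List (Fin N) → Subset N
  toSubset = foldr (λ x X → ⁅ x ⁆ ∪ X) ⊥

  ∈-toSubset⁺ : ∀ {N} {x : Fin N} {xs} → x ∈ xs → x ∈ˢ toSubset xs
  ∈-toSubset⁺ {xs = x ∷ xs} (here refl) = x∈p∪q⁺ (inj₁ (x∈⁅x⁆ x))
  ∈-toSubset⁺               (there x∈)  = x∈p∪q⁺ (inj₂ (∈-toSubset⁺ x∈))

  ∈-toSubset⁻ : ∀ {N} {x : Fin N} xs → x ∈ˢ toSubset xs → x ∈ xs
  ∈-toSubset⁻ []       x∈ = contradiction x∈ ∉⊥
  ∈-toSubset⁻ (y ∷ xs) x∈ with x∈p∪q⁻ ⁅ y ⁆ (toSubset xs) x∈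
  ... | inj₁ x∈⁅y⁆ = here (x∈⁅y⁆⇒x≡y y x∈⁅y⁆)
  ... | inj₂ x∈xs  = there (∈-toSubset⁻ xs x∈xs)

  ∣⁅x⁆∪p∣ : ∀ {N} (x : Fin N) (p : Subset N) → x ∉ˢ p → ∣ ⁅ x ⁆ ∪ p ∣ ≡ suc ∣ p ∣
  ∣⁅x⁆∪p∣ zero    (inside  ∷ p) x∉p = contradiction here x∉p
  ∣⁅x⁆∪p∣ zero    (outside ∷ p) x∉p = cong (suc ∘ ∣_∣) (∪-identityˡ p)
  ∣⁅x⁆∪p∣ (suc x) (inside  ∷ p) x∉p = cong suc (∣⁅x⁆∪p∣ x p (x∉p ∘ there))
  ∣⁅x⁆∪p∣ (suc x) (outside ∷ p) x∉p = ∣⁅x⁆∪p∣ x p (x∉p ∘ there)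

  ∣toSubset∣ : ∀ {N} {xs : List (Fin N)} → Unique xs → ∣ toSubset xs ∣ ≡ length xs
  ∣toSubset∣ {N} [] = ∣⊥∣≡0 N
  ∣toSubset∣ {xs = x ∷ xs} (x∉ ∷ xs!) = trans
    (∣⁅x⁆∪p∣ x (toSubset xs) (All¬⇒¬Any x∉ ∘ ∈-toSubset⁻ xs)) (cong suc (∣toSubset∣ xs!))

  -- Filtering keeps the order of `V`, so every subset of `toSubset V` is represented by a sublist
  -- of `V`, the form in which `fewColours` controls colours.
  toSubset-filter : ∀ {N} {X : Subset N} {V} → X ⊆ˢ toSubset V → toSubset (filter (_∈ˢ? X) V) ≡ X
  toSubset-filter {X = X} {V} X⊆V = ⊆-antisym
    (λ x∈ → proj₂ (∈-filter⁻ (_∈ˢ? X) {xs = V} (∈-toSubset⁻ (filter (_∈ˢ? X) V) x∈)))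
    (λ x∈ → ∈-toSubset⁺ (∈-filter⁺ (_∈ˢ? X) (∈-toSubset⁻ V (X⊆V x∈)) x∈))

  All-reduce : {A B : Set} {P : A → Set} {Q : B → Set} {f : ∀ {x} → P x → B} →
               (∀ {x} (px : P x) → Q (f px)) → ∀ {xs} (pxs : All P xs) → All Q (All.reduce f pxs)
  All-reduce Qf []         = []
  All-reduce Qf (px ∷ pxs) = Qf px ∷ All-reduce Qf pxs

  subsetsOf⊆ : ∀ {N k} (V : Subset N) (∣V∣≤k : ∣ V ∣ ≤ k) → All (λ X → proj₁ X ⊆ˢ V) (subsetsOf V ∣V∣≤k)
  subsetsOf⊆ {N} V ∣V∣≤k = All-reduce (λ {x} X⊆V → λ {z} → X⊆V {z}) (all-filter _ (allSubsets N))

  -- The rounds colour arbitrary lists, so `φ` is made total with a default colour `c` on sets of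
  -- more than `k` elements; sublists of the final `V` represent smaller sets and get their true
  -- colour.
  extendBy : ∀ {N k m} → Fin m → (Subset≤ N k → Fin m) → Subset N → Fin m
  extendBy {k = k} c φ X with ∣ X ∣ ≤? k
  ... | yes ∣X∣≤k = φ (X , ∣X∣≤k)
  ... | no  _     = c

  extendBy-≡ : ∀ {N k m} (c : Fin m) (φ : Subset≤ N k → Fin m) X (∣X∣≤k : ∣ X ∣ ≤ k) →
               extendBy c φ X ≡ φ (X , ∣X∣≤k)
  extendBy-≡ {k = k} c φ X ∣X∣≤k with ∣ X ∣ ≤? k
  ... | yes p  = cong (λ p → φ (X , p)) (≤-irrelevant p ∣X∣≤k)
  ... | no  ≰k = contradiction ∣X∣≤k ≰k

  colours⊆ : ∀ {N k m} (c : Fin m) (φ : Subset≤ N k → Fin m) V {C} →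
             (∀ {X} → X ⊑ V → extendBy c φ (toSubset X) ∈ C) → (∣V∣≤k : ∣ toSubset V ∣ ≤ k) →
             ∀ {d} → d ∈ map φ (subsetsOf (toSubset V) ∣V∣≤k) → d ∈ C
  colours⊆ c φ V {C} f∈C ∣V∣≤k d∈ with (X , ∣X∣≤k) , X∈ , refl ← ∈-map⁻ φ d∈ =
    subst (_∈ C)
      (trans (cong (extendBy c φ) (toSubset-filter {V = V} (All.lookup (subsetsOf⊆ (toSubset V) ∣V∣≤k) X∈)))
             (extendBy-≡ c φ X ∣X∣≤k))
      (f∈C (Sublist.filter-⊆ (_∈ˢ? X) V))

  fewColouredSubset : ∀ {k m i N} → 2 ≤ m → i ≤ k → ramseyBound m i k ≤ N → (φ : Subset≤ N k → Fin m) →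
    Σ[ V ∈ Subset N ] Σ[ ∣V∣≡k ∈ ∣ V ∣ ≡ k ] #colours φ V (≤-reflexive ∣V∣≡k) ≤ 2 ^ (k ∸ i) + i
  fewColouredSubset {k} {m@(suc _)} {i} {N} 2≤m i≤k bound φ
    with V , C , length-V , V⊑ , length-C , f∈C ← fewColours 2≤m i k i≤k (extendBy zero φ ∘ toSubset)
           (allFin N) (subst (ramseyBound m i k ≤_) (sym (length-tabulate {n = N} (λ x → x))) bound)
    = let ∣V∣≡k = trans (∣toSubset∣ (Unique-⊑ V⊑ (allFin⁺ N))) length-V
          colours = map φ (subsetsOf (toSubset V) (≤-reflexive ∣V∣≡k))
      in toSubset V , ∣V∣≡k
       , ≤-trans (Unique-length-≤ (deduplicate-! Fin._≟_ colours)
                    (colours⊆ zero φ V f∈C (≤-reflexive ∣V∣≡k) ∘ ∈-deduplicate⁻ Fin._≟_ colours))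
                 length-C

-- Integer lower bounds for the real tower

module RealTower where

  open import Algebra.Bundles using (CommutativeRing)
  open import Data.Integer as ℤ using (ℤ; +_)
  import Data.Integer.Properties as ℤ
  open import Data.Nat as ℕ using (ℕ; zero; suc; z≤n; s≤s)
  import Data.Nat.Properties as ℕ
  open import Data.Rational
  open import Data.Rational.Properties
  import Data.Rational.Unnormalised as ℚᵘ
  import Data.Rational.Unnormalised.Properties as ℚᵘ
  open import Algebra.Properties.CommutativeSemiring.Exp (CommutativeRing.commutativeSemiring +-*-commutativeRing) using (_^_)
  open import Defs
  open EndHomogeneity using (ramseyBound)
  open TowerBound

  ℤ→ℚ : ℤ → ℚ
  ℤ→ℚ i = i / 1

  ℤ→ℚ-homo-+ : ∀ i j → ℤ→ℚ (i ℤ.+ j) ≡ ℤ→ℚ i + ℤ→ℚ j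
  ℤ→ℚ-homo-+ i j = toℚᵘ-injective (begin
    toℚᵘ (ℤ→ℚ (i ℤ.+ j))                 ≈⟨ toℚᵘ-/ (i ℤ.+ j) 0 ⟩
    ℚᵘ.mkℚᵘ (i ℤ.+ j) 0                  ≈⟨ ℚᵘ.*≡* (cong (ℤ._* + 1) (sym (cong₂ ℤ._+_ (ℤ.*-identityʳ i) (ℤ.*-identityʳ j)))) ⟩
    ℚᵘ.mkℚᵘ i 0 ℚᵘ.+ ℚᵘ.mkℚᵘ j 0         ≈⟨ ℚᵘ.+-cong (toℚᵘ-/ i 0) (toℚᵘ-/ j 0) ⟨
    toℚᵘ (ℤ→ℚ i) ℚᵘ.+ toℚᵘ (ℤ→ℚ j)       ≈⟨ toℚᵘ-homo-+ (ℤ→ℚ i) (ℤ→ℚ j) ⟨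
    toℚᵘ (ℤ→ℚ i + ℤ→ℚ j)                 ∎)
    where open ℚᵘ.≃-Reasoning

  ℤ→ℚ-homo-* : ∀ i j → ℤ→ℚ (i ℤ.* j) ≡ ℤ→ℚ i * ℤ→ℚ j
  ℤ→ℚ-homo-* i j = toℚᵘ-injective (begin
    toℚᵘ (ℤ→ℚ (i ℤ.* j))                 ≈⟨ toℚᵘ-/ (i ℤ.* j) 0 ⟩
    ℚᵘ.mkℚᵘ i 0 ℚᵘ.* ℚᵘ.mkℚᵘ j 0         ≈⟨ ℚᵘ.*-cong (toℚᵘ-/ i 0) (toℚᵘ-/ j 0) ⟨
    toℚᵘ (ℤ→ℚ i) ℚᵘ.* toℚᵘ (ℤ→ℚ j)       ≈⟨ toℚᵘ-homo-* (ℤ→ℚ i) (ℤ→ℚ j) ⟨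
    toℚᵘ (ℤ→ℚ i * ℤ→ℚ j)                 ∎)
    where open ℚᵘ.≃-Reasoning

  ℕ→ℚ-homo-+ : ∀ a b → ℕ→ℚ (a ℕ.+ b) ≡ ℕ→ℚ a + ℕ→ℚ b
  ℕ→ℚ-homo-+ a b = ℤ→ℚ-homo-+ (+ a) (+ b)

  ℕ→ℚ-homo-* : ∀ a b → ℕ→ℚ (a ℕ.* b) ≡ ℕ→ℚ a * ℕ→ℚ b
  ℕ→ℚ-homo-* a b = trans (cong ℤ→ℚ (ℤ.pos-* a b)) (ℤ→ℚ-homo-* (+ a) (+ b))

  ℕ→ℚ-homo-^ : ∀ a n → ℕ→ℚ (a ℕ.^ n) ≡ ℕ→ℚ a ^ n
  ℕ→ℚ-homo-^ a zero    = refl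
  ℕ→ℚ-homo-^ a (suc n) = trans (ℕ→ℚ-homo-* a (a ℕ.^ n)) (cong (ℕ→ℚ a *_) (ℕ→ℚ-homo-^ a n))

  ℕ→ℚ-mono-< : ∀ {m n} → m ℕ.< n → ℕ→ℚ m < ℕ→ℚ n
  ℕ→ℚ-mono-< {m} m<n = <-≤-trans
    (subst₂ _<_ (+-identityˡ (ℕ→ℚ m)) (sym (ℕ→ℚ-homo-+ 1 m)) (+-monoˡ-< (ℕ→ℚ m) (positive⁻¹ 1ℚ)))
    (ℕ→ℚ-mono m<n)

  ℕ→ℚ-pos : ∀ n .{{_ : ℕ.NonZero n}} → Positive (ℕ→ℚ n)
  ℕ→ℚ-pos (suc n) = positive (ℕ→ℚ-mono-< {0} {suc n} (s≤s z≤n))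

  /-* : ∀ i d .{{_ : ℕ.NonZero d}} → (i / d) * ℕ→ℚ d ≡ ℤ→ℚ i
  /-* i d@(suc d-1) = toℚᵘ-injective (begin
    toℚᵘ ((i / d) * ℕ→ℚ d)                  ≈⟨ toℚᵘ-homo-* (i / d) (ℕ→ℚ d) ⟩
    toℚᵘ (i / d) ℚᵘ.* toℚᵘ (ℕ→ℚ d)          ≈⟨ ℚᵘ.*-cong (toℚᵘ-/ i d-1) (toℚᵘ-/ (+ d) 0) ⟩
    ℚᵘ.mkℚᵘ i d-1 ℚᵘ.* ℚᵘ.mkℚᵘ (+ d) 0      ≈⟨ ℚᵘ.*≡* (trans (ℤ.*-identityʳ (i ℤ.* + d)) (cong (λ e → i ℤ.* + e) (sym (ℕ.*-identityʳ d)))) ⟩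
    ℚᵘ.mkℚᵘ i 0                             ≈⟨ toℚᵘ-/ i 0 ⟨
    toℚᵘ (ℤ→ℚ i)                            ∎)
    where open ℚᵘ.≃-Reasoning

  </⇒*< : ∀ {q} i d .{{_ : ℕ.NonZero d}} → q < i / d → q * ℕ→ℚ d < ℤ→ℚ i
  </⇒*< {q} i d q< = subst (q * ℕ→ℚ d <_) (/-* i d) (*-monoˡ-<-pos (ℕ→ℚ d) {{ℕ→ℚ-pos d}} q<)

  *<⇒</ : ∀ {q} i d .{{_ : ℕ.NonZero d}} → q * ℕ→ℚ d < ℤ→ℚ i → q < i / d
  *<⇒</ {q} i d q< = *-cancelʳ-<-nonNeg (ℕ→ℚ d) {{pos⇒nonNeg (ℕ→ℚ d) {{ℕ→ℚ-pos d}}}}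
    (subst (q * ℕ→ℚ d <_) (sym (/-* i d)) q<)

  ℕ→ℝ-cancel-≤ : ∀ {m n} → ℕ→ℝ m ≤ᴿ ℕ→ℝ n → m ℕ.≤ n
  ℕ→ℝ-cancel-≤ m≤n = ℕ.≮⇒≥ λ n<m → <-irrefl refl (m≤n (ℕ→ℚ-mono-< n<m))

  -- The cut of `log⁺` does not mention the positivity proof, so it is the same for the given proof
  -- and the one that `log` decides.
  log⁺⇒log : ∀ {a q} 0<a → cut (log⁺ a 0<a) q → cut (log a) q
  log⁺⇒log {a} 0<a q< with 0ℚ <? a
  ... | yes _   = q<
  ... | no  0≮a = contradiction 0<a 0≮a

  log⇒log⁺ : ∀ {a q} 0<a → cut (log a) q → cut (log⁺ a 0<a) q
  log⇒log⁺ {a} 0<a q< with 0ℚ <? a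
  ... | yes _   = q<
  ... | no  0≮a = contradiction 0<a 0≮a

  -- A rational `q` below `a + b` has to be split: density gives `r` between `q - b` and `a`, then
  -- `s` between `q - r` and `b`.
  ℕ→ℝ-+-≤ : ∀ a b x y → ℕ→ℝ a ≤ᴿ x → ℕ→ℝ b ≤ᴿ y → ℕ→ℝ (a ℕ.+ b) ≤ᴿ x +ᴿ y
  ℕ→ℝ-+-≤ a b x y a≤x b≤y {q} q<a+b =
    let r , q-b<r , r<a = <-dense q-b<a
        s , q-r<s , s<b = <-dense (swap-minus {q} q-b<r)
    in r , s , a≤x r<a , b≤y s<b , subst₂ _<_ (cancel q r) (+-comm s r) (+-monoˡ-< r q-r<s)
    where
    cancel : ∀ x y → x - y + y ≡ x
    cancel x y = trans (+-assoc x (- y) y) (trans (cong (_+_ x) (+-inverseˡ y)) (+-identityʳ x))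
    minus-< : ∀ {x y z} → x < z + y → x - y < z
    minus-< {x} {y} {z} x< = subst (x - y <_)
      (trans (+-assoc z y (- y)) (trans (cong (_+_ z) (+-inverseʳ y)) (+-identityʳ z))) (+-monoˡ-< (- y) x<)
    q-b<a : q - ℕ→ℚ b < ℕ→ℚ a
    q-b<a = minus-< {q} (subst (q <_) (ℕ→ℚ-homo-+ a b) q<a+b)
    swap-minus : ∀ {x y z} → x - y < z → x - z < y
    swap-minus {x} {y} {z} x-y<z = minus-< {x} (subst₂ _<_ (cancel x y) (+-comm z y) (+-monoˡ-< y x-y<z))

  -- The fraction `l / 2` witnesses the cut of `log k`, since its condition reads 2 ^ l < k ^ 2.
  log-lower : ∀ k l .{{_ : ℕ.NonZero k}} → 2 ℕ.^ l ℕ.< k ℕ.* k → ℕ→ℝ l ≤ᴿ 2ℚ · log (ℕ→ℚ k)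
  log-lower k l 2^l<k² {q} q<l =
    let a , ½q<a , a<½l = <-dense (*-monoˡ-<-pos ½ q<l)
    in a , log⁺⇒log 0<k (+ l , 1 , subst (a <_) half-l a<½l , pow-<)
     , subst₂ _<_ (double-half q) (*-comm a 2ℚ) (*-monoˡ-<-pos 2ℚ ½q<a)
    where
    0<k = positive⁻¹ (ℕ→ℚ k) {{ℕ→ℚ-pos k}}
    double-half : ∀ x → x * ½ * 2ℚ ≡ x
    double-half x = trans (*-assoc x ½ 2ℚ) (*-identityʳ x)
    half-l : ℕ→ℚ l * ½ ≡ + l / 2
    half-l = trans (cong (_* ½) (sym (/-* (+ l) 2)))
      (trans (*-assoc (+ l / 2) 2ℚ ½) (*-identityʳ (+ l / 2)))
    pow-< : pow2 (+ l) < ℕ→ℚ k ^ 2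
    pow-< = subst₂ _<_ (ℕ→ℚ-homo-^ 2 l)
      (trans (ℕ→ℚ-homo-* k k) (cong (ℕ→ℚ k *_) (sym (*-identityʳ (ℕ→ℚ k))))) (ℕ→ℚ-mono-< 2^l<k²)

  exp₂-lower : ∀ {a x} → 0 ℕ.< a → ℕ→ℝ a ≤ᴿ x → ℕ→ℝ (2 ℕ.^ ℕ.pred a) ≤ᴿ exp₂ x
  exp₂-lower {suc a} {x} _ a<x {q} q<2^a with 0ℚ ≤? q
  -- The cut of `exp₂` wants a nonnegative `s` above `q`; for negative `q` it can be 0.
  ... | no 0≰q = + a , 0 , 0ℚ , a<x (ℕ→ℚ-mono-< (ℕ.n<1+n a)) , ≤-refl , 0^<pow2 (+ a) 0 , ≰⇒> 0≰q
  ... | yes 0≤q = let s , q<s , s<2^a = <-dense q<2^a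
    in + a , 0 , s , a<x (ℕ→ℚ-mono-< (ℕ.n<1+n a)) , ≤-trans 0≤q (<⇒≤ q<s)
     , subst₂ _<_ (sym (*-identityʳ s)) (ℕ→ℚ-homo-^ 2 a) s<2^a , q<s

  weakTower≤tower₂ : ∀ j a x → 0 ℕ.< a → ℕ→ℝ a ≤ᴿ x → ℕ→ℝ (weakTower j a) ≤ᴿ tower₂ j x
  weakTower≤tower₂ zero    a x _   a≤x = a≤x
  weakTower≤tower₂ (suc j) a x 0<a a≤x =
    exp₂-lower {x = tower₂ j x} (0<weakTower j 0<a) (weakTower≤tower₂ j a x 0<a a≤x)

  k+l+2≤ : ∀ k l .{{_ : ℕ.NonZero k}} → 2 ℕ.^ l ℕ.< k ℕ.* k →
           ℕ→ℝ (k ℕ.+ l ℕ.+ 2) ≤ᴿ ℕ→ℝ k +ᴿ 2ℚ · log (ℕ→ℚ k) +ᴿ ℕ→ℝ 2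
  k+l+2≤ k l 2^l<k² = ℕ→ℝ-+-≤ (k ℕ.+ l) 2 (ℕ→ℝ k +ᴿ 2ℚ · log (ℕ→ℚ k)) (ℕ→ℝ 2)
    (ℕ→ℝ-+-≤ k l (ℕ→ℝ k) (2ℚ · log (ℕ→ℚ k)) (λ q< → q<) (log-lower k l 2^l<k²)) (λ q< → q<)

  weakTower≤ : ∀ j a N x → 0 ℕ.< a → ℕ→ℝ a ≤ᴿ x → tower₂ j x ≤ᴿ ℕ→ℝ N → weakTower j a ℕ.≤ N
  weakTower≤ j a N x 0<a a≤x tower≤N = ℕ→ℝ-cancel-≤ (λ q< → tower≤N (weakTower≤tower₂ j a x 0<a a≤x q<))

  ramseyBound≤N : ∀ {k m i N} → 2 ℕ.≤ k → i ℕ.≤ k → m ℕ.≤ 2 ℕ.^ k →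
    tower₂ (suc i) (ℕ→ℝ k +ᴿ 2ℚ · log (ℕ→ℚ k) +ᴿ ℕ→ℝ 2) ≤ᴿ ℕ→ℝ N → ramseyBound m i k ℕ.≤ N
  ramseyBound≤N {k} {m} {i} {N} 2≤k i≤k m≤2^k tower≤N =
    let k≢0 = ℕ.>-nonZero (ℕ.≤-trans (s≤s z≤n) 2≤k)
        l , 2^l<k² , k²≤2^1+l = 2^<≤2^1+ (k ℕ.* k) (ℕ.≤-trans 2≤k (ℕ.m≤m*n k k {{k≢0}}))
    in ℕ.≤-trans (ramseyBound≤weakTower 2≤k m≤2^k k²≤2^1+l i i≤k)
         (weakTower≤ (suc i) (k ℕ.+ l ℕ.+ 2) N (ℕ→ℝ k +ᴿ 2ℚ · log (ℕ→ℚ k) +ᴿ ℕ→ℝ 2)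
           (ℕ.m≤n⇒m≤o+n (k ℕ.+ l) (s≤s z≤n)) (k+l+2≤ k l {{k≢0}} 2^l<k²) tower≤N)

-- Gibbs' inequality in natural numbers

module GibbsInequality where

  open import Data.Nat
  open import Data.Nat.ListAction using (sum; product)
  open import Data.Nat.ListAction.Properties using (sum-++; product-++)
  open import Data.Nat.Properties
  open import Data.Nat.Tactic.RingSolver using (solve-∀)
  open EndHomogeneity using (length-filter-∁)

  ^-distribʳ-* : ∀ k m n → (m * n) ^ k ≡ m ^ k * n ^ k
  ^-distribʳ-* zero    m n = refl
  ^-distribʳ-* (suc k) m n = trans (cong (m * n *_) (^-distribʳ-* k m n)) (swap m n (m ^ k) (n ^ k))
    where
    swap : ∀ m n x y → m * n * (x * y) ≡ m * x * (n * y)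
    swap = solve-∀

  -- Tangent of a ↦ a ^ (1 + n) at b, with the subtracted term moved across.
  power-tangent : ∀ a b n → suc n * (a * b ^ n) ≤ a ^ suc n + n * b ^ suc n
  power-tangent a b zero    = ≤-reflexive (base a)
    where
    base : ∀ a → 1 * (a * 1) ≡ a * 1 + 0
    base = solve-∀
  power-tangent a b (suc n) = +-cancelʳ-≤ (n * (a * (b * B))) _ _ (begin
    suc (suc n) * (a * (b * B)) + n * (a * (b * B))           ≡⟨ left a b B n ⟩
    suc n * B * (2 * (a * b))                                 ≤⟨ *-monoʳ-≤ (suc n * B) (2ab≤a²+b² a b) ⟩
    suc n * B * (a * a + b * b)                               ≡⟨ middle a b B n ⟩
    a * (suc n * (a * B)) + suc n * (b * (b * B))             ≤⟨ +-monoˡ-≤ _ (*-monoʳ-≤ a (power-tangent a b n)) ⟩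
    a * (a * A + n * (b * B)) + suc n * (b * (b * B))         ≡⟨ right a b A B n ⟩
    a * (a * A) + suc n * (b * (b * B)) + n * (a * (b * B))   ∎)
    where
    open ≤-Reasoning
    A = a ^ n
    B = b ^ n
    left : ∀ a b B n → suc (suc n) * (a * (b * B)) + n * (a * (b * B)) ≡ suc n * B * (2 * (a * b))
    left = solve-∀
    middle : ∀ a b B n → suc n * B * (a * a + b * b) ≡ a * (suc n * (a * B)) + suc n * (b * (b * B))
    middle = solve-∀
    right : ∀ a b A B n → a * (a * A + n * (b * B)) + suc n * (b * (b * B)) ≡ a * (a * A) + suc n * (b * (b * B)) + n * (a * (b * B))
    right = solve-∀
    square : ∀ a d → 2 * (a * (a + d)) + d * d ≡ a * a + (a + d) * (a + d)
    square = solve-∀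
    ordered : ∀ {a b} → a ≤ b → 2 * (a * b) ≤ a * a + b * b
    ordered {a} a≤b with d , refl ← m≤n⇒∃[o]m+o≡n a≤b = ≤-trans (m≤m+n _ (d * d)) (≤-reflexive (square a d))
    2ab≤a²+b² : ∀ a b → 2 * (a * b) ≤ a * a + b * b
    2ab≤a²+b² a b with ≤-total a b
    ... | inj₁ a≤b = ordered a≤b
    ... | inj₂ b≤a = subst₂ _≤_ (cong (2 *_) (*-comm b a)) (+-comm (b * b) (a * a)) (ordered b≤a)

  -- `power-tangent` at `a = n * (x + S)` and `b = suc n * S`: these are the mean after adding `x`
  -- and the mean before, both multiplied by `n * suc n`. The term `n * b ^ suc n` then cancels.
  am-gm-step : ∀ n x S → suc n ^ suc n * (x * S ^ n) ≤ (x + S) ^ suc n * n ^ n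
  am-gm-step zero x S = ≤-trans (m≤m+n _ S) (≤-reflexive (base x S))
    where
    base : ∀ x S → 1 * (x * 1) + S ≡ (x + S) * 1 * 1
    base = solve-∀
  am-gm-step n@(suc _) x S = *-cancelˡ-≤ n (+-cancelʳ-≤ (n * b ^ suc n) _ _ (begin
    n * (suc n ^ suc n * (x * S ^ n)) + n * b ^ suc n
      ≡⟨ cong (λ z → n * (suc n ^ suc n * (x * S ^ n)) + n * (b * z)) b^n ⟩
    n * (suc n ^ suc n * (x * S ^ n)) + n * (b * (suc n ^ n * S ^ n))
      ≡⟨ left n x S (suc n ^ n) (S ^ n) ⟩
    suc n * (a * (suc n ^ n * S ^ n))
      ≡⟨ cong (λ z → suc n * (a * z)) b^n ⟨
    suc n * (a * b ^ n)
      ≤⟨ power-tangent a b n ⟩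
    a ^ suc n + n * b ^ suc n
      ≡⟨ cong (_+ n * b ^ suc n) (trans (^-distribʳ-* (suc n) n (x + S)) (right n (n ^ n) ((x + S) ^ suc n))) ⟩
    n * ((x + S) ^ suc n * n ^ n) + n * b ^ suc n ∎))
    where
    open ≤-Reasoning
    a = n * (x + S)
    b = suc n * S
    b^n : b ^ n ≡ suc n ^ n * S ^ n
    b^n = ^-distribʳ-* n (suc n) S
    left : ∀ n x S C D → n * (suc n * C * (x * D)) + n * (suc n * S * (C * D)) ≡ suc n * (n * (x + S) * (C * D))
    left = solve-∀
    right : ∀ n D E → n * D * E ≡ n * (E * D)
    right = solve-∀

  n^n≢0 : ∀ n → NonZero (n ^ n)
  n^n≢0 zero    = _
  n^n≢0 (suc n) = m^n≢0 (suc n) (suc n)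

  am-gm : ∀ xs → length xs ^ length xs * product xs ≤ sum xs ^ length xs
  am-gm []       = ≤-refl
  am-gm (x ∷ xs) = *-cancelʳ-≤ _ _ (n ^ n) {{n^n≢0 n}} (begin
    suc n ^ suc n * (x * product xs) * n ^ n    ≡⟨ arrange (suc n ^ suc n) x (product xs) (n ^ n) ⟩
    suc n ^ suc n * (x * (n ^ n * product xs))  ≤⟨ *-monoʳ-≤ (suc n ^ suc n) (*-monoʳ-≤ x (am-gm xs)) ⟩
    suc n ^ suc n * (x * sum xs ^ n)            ≤⟨ am-gm-step n x (sum xs) ⟩
    (x + sum xs) ^ suc n * n ^ n                ∎)
    where
    open ≤-Reasoning
    n = length xs
    arrange : ∀ c x p d → c * (x * p) * d ≡ c * (x * (d * p))
    arrange = solve-∀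

  sum-replicate : ∀ n x → sum (replicate n x) ≡ n * x
  sum-replicate zero    x = refl
  sum-replicate (suc n) x = cong (x +_) (sum-replicate n x)

  product-replicate : ∀ n x → product (replicate n x) ≡ x ^ n
  product-replicate zero    x = refl
  product-replicate (suc n) x = cong (x *_) (product-replicate n x)

  -- AM-GM for A copies of K * b and b copies of A.
  gibbs-step : ∀ K A b → (b + A) ^ (b + A) * K ^ A ≤ suc K ^ (b + A) * (b ^ b * A ^ A)
  gibbs-step K A zero = begin
    A ^ A * K ^ A              ≤⟨ *-monoʳ-≤ (A ^ A) (^-monoˡ-≤ A (n≤1+n K)) ⟩
    A ^ A * suc K ^ A          ≡⟨ *-comm (A ^ A) (suc K ^ A) ⟩
    suc K ^ A * A ^ A          ≡⟨ cong (suc K ^ A *_) (*-identityˡ (A ^ A)) ⟨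
    suc K ^ A * (1 * A ^ A)    ∎
    where open ≤-Reasoning
  gibbs-step K zero b@(suc _) = begin
    (b + 0) ^ (b + 0) * 1                  ≡⟨ cong (λ n → n ^ n * 1) (+-identityʳ b) ⟩
    b ^ b * 1                              ≤⟨ m≤n*m (b ^ b * 1) (suc K ^ (b + 0)) {{m^n≢0 (suc K) (b + 0)}} ⟩
    suc K ^ (b + 0) * (b ^ b * 1)          ∎
    where open ≤-Reasoning
  gibbs-step K A@(suc _) b@(suc _) = *-cancelʳ-≤ _ _ (b ^ A * A ^ b) {{m*n≢0 _ _ {{m^n≢0 b A}} {{m^n≢0 A b}}}} (begin
    (b + A) ^ (b + A) * K ^ A * (b ^ A * A ^ b)    ≡⟨ left ((b + A) ^ (b + A)) (K ^ A) (b ^ A) (A ^ b) ⟩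
    (b + A) ^ (b + A) * (A ^ b * (K ^ A * b ^ A))  ≡⟨ cong₂ (λ n p → n ^ n * p) (sym length-xs) (sym product-xs) ⟩
    length xs ^ length xs * product xs             ≤⟨ am-gm xs ⟩
    sum xs ^ length xs                             ≡⟨ cong₂ _^_ sum-xs length-xs ⟩
    (suc K * (A * b)) ^ (b + A)                    ≡⟨ ^-distribʳ-* (b + A) (suc K) (A * b) ⟩
    suc K ^ (b + A) * (A * b) ^ (b + A)            ≡⟨ cong (suc K ^ (b + A) *_) power ⟩
    suc K ^ (b + A) * (A ^ b * A ^ A * (b ^ b * b ^ A)) ≡⟨ right (suc K ^ (b + A)) (A ^ b) (A ^ A) (b ^ b) (b ^ A) ⟩
    suc K ^ (b + A) * (b ^ b * A ^ A) * (b ^ A * A ^ b) ∎)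
    where
    open ≤-Reasoning
    xs = replicate b A ++ replicate A (K * b)
    length-xs : length xs ≡ b + A
    length-xs = trans (length-++ (replicate b A)) (cong₂ _+_ (length-replicate b) (length-replicate A))
    product-xs : product xs ≡ A ^ b * (K ^ A * b ^ A)
    product-xs = trans (product-++ (replicate b A) (replicate A (K * b)))
      (cong₂ _*_ (product-replicate b A) (trans (product-replicate A (K * b)) (^-distribʳ-* A K b)))
    total : ∀ K A b → b * A + A * (K * b) ≡ suc K * (A * b)
    total = solve-∀
    sum-xs : sum xs ≡ suc K * (A * b)
    sum-xs = trans (sum-++ (replicate b A) (replicate A (K * b)))
      (trans (cong₂ _+_ (sum-replicate b A) (sum-replicate A (K * b))) (total K A b))
    power : (A * b) ^ (b + A) ≡ A ^ b * A ^ A * (b ^ b * b ^ A)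
    power = trans (^-distribʳ-* (b + A) A b) (cong₂ _*_ (^-distribˡ-+-* A b A) (^-distribˡ-+-* b b A))
    left : ∀ s k p q → s * k * (p * q) ≡ s * (q * (k * p))
    left = solve-∀
    right : ∀ k x y z w → k * (x * y * (z * w)) ≡ k * (z * y) * (w * x)
    right = solve-∀

  selfPowers : List ℕ → ℕ
  selfPowers ns = product (map (λ n → n ^ n) ns)

  -- Split off one class: `gibbs-step` compares it with `K` equal classes of total size `A`, and the
  -- induction hypothesis replaces these by the actual ones. The cancelled `K ^ A` is nonzero even
  -- for `K = 0`, where it is `0 ^ 0`.
  gibbs : ∀ ns → sum ns ^ sum ns ≤ length ns ^ sum ns * selfPowers ns
  gibbs []       = ≤-refl
  gibbs (b ∷ ns) = *-cancelʳ-≤ _ _ (K ^ A) {{K^A≢0 ns}} (begin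
    (b + A) ^ (b + A) * K ^ A                ≤⟨ gibbs-step K A b ⟩
    suc K ^ (b + A) * (b ^ b * A ^ A)        ≤⟨ *-monoʳ-≤ (suc K ^ (b + A)) (*-monoʳ-≤ (b ^ b) (gibbs ns)) ⟩
    suc K ^ (b + A) * (b ^ b * (K ^ A * P))  ≡⟨ arrange (suc K ^ (b + A)) (b ^ b) (K ^ A) P ⟩
    suc K ^ (b + A) * (b ^ b * P) * K ^ A    ∎)
    where
    open ≤-Reasoning
    A = sum ns
    K = length ns
    P = selfPowers ns
    K^A≢0 : ∀ ns → NonZero (length ns ^ sum ns)
    K^A≢0 []       = _
    K^A≢0 (n ∷ ns) = m^n≢0 (suc (length ns)) (n + sum ns)
    arrange : ∀ k b c p → k * (b * (c * p)) ≡ k * (b * p) * c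
    arrange = solve-∀

  module _ {A : Set} {m : ℕ} (f : A → Fin m) where

    count : List A → Fin m → ℕ
    count Ω c = length (filter (λ x → f x Fin.≟ c) Ω)

    count-filter-≢ : ∀ {c d} → c ≢ d → ∀ Ω → count (filter (λ x → ¬? (f x Fin.≟ c)) Ω) d ≡ count Ω d
    count-filter-≢ c≢d [] = refl
    count-filter-≢ {c} {d} c≢d (x ∷ Ω) with f x Fin.≟ c | f x Fin.≟ d in eq
    ... | yes fx≡c | yes fx≡d = contradiction (trans (sym fx≡c) fx≡d) c≢d
    ... | yes _    | no _     = count-filter-≢ c≢d Ω
    ... | no _     | yes _  rewrite eq = cong suc (count-filter-≢ c≢d Ω)
    ... | no _     | no _   rewrite eq = count-filter-≢ c≢d Ω

    -- Remove the class of the first colour from `Ω`; as colours are listed once, the other counts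
    -- do not change.
    sum-count : ∀ {cs} → Unique cs → ∀ Ω → (∀ {x} → x ∈ Ω → f x ∈ cs) → sum (map (count Ω) cs) ≡ length Ω
    sum-count []         []      _   = refl
    sum-count []         (x ∷ Ω) f∈  with () ← f∈ (here refl)
    sum-count {c ∷ cs} (c∉cs ∷ cs!) Ω f∈ = begin
      count Ω c + sum (map (count Ω) cs)   ≡⟨ cong (λ ns → count Ω c + sum ns) counts-Ω′ ⟩
      count Ω c + sum (map (count Ω′) cs)  ≡⟨ cong (count Ω c +_) (sum-count cs! Ω′ f∈cs) ⟩
      count Ω c + length Ω′                ≡⟨ length-filter-∁ (λ x → f x Fin.≟ c) Ω ⟩
      length Ω                             ∎
      where
      open ≡-Reasoning
      Ω′ = filter (λ x → ¬? (f x Fin.≟ c)) Ω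
      counts-Ω′ : map (count Ω) cs ≡ map (count Ω′) cs
      counts-Ω′ = map-cong-local (All.map (λ c≢d → sym (count-filter-≢ c≢d Ω)) c∉cs)
      f∈cs : ∀ {x} → x ∈ Ω′ → f x ∈ cs
      f∈cs x∈ with x∈Ω , fx≢c ← ∈-filter⁻ (λ x → ¬? (f x Fin.≟ c)) {xs = Ω} x∈ with f∈ x∈Ω
      ... | here fx≡c  = contradiction fx≡c fx≢c
      ... | there fx∈ = fx∈

-- From cuts of logarithms to the entropy bound

module EntropyBound where

  open import Algebra.Bundles using (CommutativeRing)
  open import Data.Integer as ℤ using (ℤ; +_; -[1+_])
  import Data.Integer.Properties as ℤ
  open import Data.Nat as ℕ using (ℕ; zero; suc; z≤n; s≤s)
  open import Data.Nat.ListAction using (sum)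
  import Data.Nat.Properties as ℕ
  import Data.Nat.Tactic.RingSolver as ℕ
  open import Data.Rational
  open import Data.Rational.Properties
  open import Data.Rational.Solver using (module +-*-Solver)
  open import Algebra.Properties.CommutativeSemiring.Exp (CommutativeRing.commutativeSemiring +-*-commutativeRing)
    using (_^_; ^-distrib-*)
  open import Defs
  open RealTower
  open GibbsInequality using (gibbs; selfPowers; n^n≢0; count; sum-count; ^-distribʳ-*)

  pow2-suc : ∀ i → pow2 (ℤ.suc i) ≡ 2ℚ * pow2 i
  pow2-suc (+ n)          = refl
  pow2-suc -[1+ zero ]    = refl
  pow2-suc -[1+ suc n ]   = trans (sym (*-identityˡ (½ ^ suc n))) (*-assoc 2ℚ ½ (½ ^ suc n))

  pow2-homo-+ : ∀ i j → pow2 (i ℤ.+ j) ≡ pow2 i * pow2 j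
  pow2-homo-+ (+ zero)  j = trans (cong pow2 (ℤ.+-identityˡ j)) (sym (*-identityˡ (pow2 j)))
  pow2-homo-+ (+ suc n) j = begin
    pow2 (ℤ.suc (+ n) ℤ.+ j)    ≡⟨ cong pow2 (ℤ.+-assoc (+ 1) (+ n) j) ⟩
    pow2 (ℤ.suc (+ n ℤ.+ j))    ≡⟨ pow2-suc (+ n ℤ.+ j) ⟩
    2ℚ * pow2 (+ n ℤ.+ j)       ≡⟨ cong (2ℚ *_) (pow2-homo-+ (+ n) j) ⟩
    2ℚ * (pow2 (+ n) * pow2 j)  ≡⟨ *-assoc 2ℚ (pow2 (+ n)) (pow2 j) ⟨
    pow2 (+ suc n) * pow2 j     ∎
    where open ≡-Reasoning
  pow2-homo-+ -[1+ n ] j = begin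
    pow2 (-[1+ n ] ℤ.+ j)                  ≡⟨ *-identityˡ (pow2 (-[1+ n ] ℤ.+ j)) ⟨
    ½ * 2ℚ * pow2 (-[1+ n ] ℤ.+ j)         ≡⟨ *-assoc ½ 2ℚ (pow2 (-[1+ n ] ℤ.+ j)) ⟩
    ½ * (2ℚ * pow2 (-[1+ n ] ℤ.+ j))       ≡⟨ cong (½ *_) (pow2-suc (-[1+ n ] ℤ.+ j)) ⟨
    ½ * pow2 (ℤ.suc (-[1+ n ] ℤ.+ j))      ≡⟨ cong (λ i → ½ * pow2 i) (ℤ.+-assoc (+ 1) -[1+ n ] j) ⟨
    ½ * pow2 (ℤ.suc -[1+ n ] ℤ.+ j)        ≡⟨ cong (½ *_) (rest n) ⟩
    ½ * (½ ^ n * pow2 j)                   ≡⟨ *-assoc ½ (½ ^ n) (pow2 j) ⟨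
    pow2 -[1+ n ] * pow2 j                 ∎
    where
    open ≡-Reasoning
    rest : ∀ n → pow2 (ℤ.suc -[1+ n ] ℤ.+ j) ≡ ½ ^ n * pow2 j
    rest zero    = pow2-homo-+ (+ zero) j
    rest (suc n) = pow2-homo-+ -[1+ n ] j

  pow2-homo-* : ∀ i n → pow2 (i ℤ.* + n) ≡ pow2 i ^ n
  pow2-homo-* i zero    = cong pow2 (ℤ.*-zeroʳ i)
  pow2-homo-* i (suc n) = begin
    pow2 (i ℤ.* + suc n)       ≡⟨ cong pow2 (ℤ.*-suc i (+ n)) ⟩
    pow2 (i ℤ.+ i ℤ.* + n)     ≡⟨ pow2-homo-+ i (i ℤ.* + n) ⟩
    pow2 i * pow2 (i ℤ.* + n)  ≡⟨ cong (pow2 i *_) (pow2-homo-* i n) ⟩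
    pow2 i ^ suc n             ∎
    where open ≡-Reasoning

  *-mono-<-≤-pos : ∀ {a b c d} → 0ℚ ≤ a → a < b → 0ℚ < c → c ≤ d → a * c < b * d
  *-mono-<-≤-pos {a} {b} {c} {d} 0≤a a<b 0<c c≤d = <-≤-trans
    (*-monoˡ-<-pos c {{positive 0<c}} a<b)
    (*-monoˡ-≤-nonNeg b {{nonNegative (≤-trans 0≤a (<⇒≤ a<b))}} c≤d)

  ^-monoˡ-< : ∀ {a b} → 0ℚ < a → a < b → ∀ n .{{_ : ℕ.NonZero n}} → a ^ n < b ^ n
  ^-monoˡ-< {a} 0<a a<b (suc n) = *-mono-<-≤-pos (<⇒≤ 0<a) a<b
    (positive⁻¹ (a ^ n) {{^-pos a {{positive 0<a}} n}}) (^-monoˡ-≤ (<⇒≤ 0<a) (<⇒≤ a<b) n)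

  1^ : ∀ n → 1ℚ ^ n ≡ 1ℚ
  1^ zero    = refl
  1^ (suc n) = trans (*-identityˡ (1ℚ ^ n)) (1^ n)

  -- Multiplying the condition 2 ^ u < (1 / p) ^ d by p ^ d removes the inverse.
  p·log[1/p]-cut : ∀ {p q} → 0ℚ < p → cut (p·log[1/p] p) q →
                   ∃[ a ] ∃₂ λ u d → q < p * a × a * ℕ→ℚ (suc d) < ℤ→ℚ u × pow2 u * p ^ suc d < 1ℚ
  p·log[1/p]-cut {p} 0<p q< with 0ℚ <? p
  ... | no  0≮p = contradiction 0<p 0≮p
  ... | yes 0<p′ with a , a< , q<pa ← q<
                 with u , d , a<u/d , pow< ← log⇒log⁺ 
                        (positive⁻¹ (1/_ p {{pos⇒nonZero p {{positive 0<p′}}}}) {{1/pos⇒pos p {{positive 0<p′}}}}) a<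
    = a , u , d , q<pa , </⇒*< u (suc d) a<u/d
    , subst (pow2 u * p ^ suc d <_) one
        (*-monoˡ-<-pos (p ^ suc d) {{^-pos p {{positive 0<p}} (suc d)}} pow<)
    where
    instance
      _ = positive 0<p′
      _ = pos⇒nonZero p
    one : (1/ p) ^ suc d * p ^ suc d ≡ 1ℚ
    one = trans (sym (^-distrib-* (1/ p) p (suc d))) (trans (cong (_^ suc d) (*-inverseˡ p)) (1^ (suc d)))

  0<ℕ→ℚ : ∀ n .{{_ : ℕ.NonZero n}} → 0ℚ < ℕ→ℚ n
  0<ℕ→ℚ n = positive⁻¹ (ℕ→ℚ n) {{ℕ→ℚ-pos n}}

  0<c/n : ∀ c n .{{_ : ℕ.NonZero c}} .{{_ : ℕ.NonZero n}} → 0ℚ < + c / n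
  0<c/n c n = *<⇒</ (+ c) n (subst (_< ℕ→ℚ c) (sym (*-zeroˡ (ℕ→ℚ n))) (0<ℕ→ℚ c))

  -- Multiplying by powers of `n` clears the denominator of the probability, so that terms can be
  -- combined through numerators and exponents.
  frequency-cut : ∀ c n .{{_ : ℕ.NonZero c}} .{{_ : ℕ.NonZero n}} {q} → cut (p·log[1/p] (+ c / n)) q →
                  ∃₂ λ u d → q * ℕ→ℚ (n ℕ.* suc d) < ℤ→ℚ u * ℕ→ℚ c
                           × pow2 u * ℕ→ℚ (c ℕ.^ suc d) < ℕ→ℚ (n ℕ.^ suc d)
  frequency-cut c n {q} q< =
    let a , u , d , q<pa , aD<u , pow< = p·log[1/p]-cut (0<c/n c n) q<
        D = ℕ→ℚ (suc d)
    in u , d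
    , (begin-strict
        q * ℕ→ℚ (n ℕ.* suc d)              ≡⟨ cong (q *_) (ℕ→ℚ-homo-* n (suc d)) ⟩
        q * (ℕ→ℚ n * D)                    <⟨ *-monoˡ-<-pos (ℕ→ℚ n * D) {{pos*pos⇒pos (ℕ→ℚ n) {{ℕ→ℚ-pos n}} D {{ℕ→ℚ-pos (suc d)}}}} q<pa ⟩
        p * a * (ℕ→ℚ n * D)                ≡⟨ arrange p a (ℕ→ℚ n) D ⟩
        a * D * (p * ℕ→ℚ n)                ≡⟨ cong (a * D *_) (/-* (+ c) n) ⟩
        a * D * ℕ→ℚ c                      <⟨ *-monoˡ-<-pos (ℕ→ℚ c) {{ℕ→ℚ-pos c}} aD<u ⟩
        ℤ→ℚ u * ℕ→ℚ c                      ∎)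
    , (begin-strict
        pow2 u * ℕ→ℚ (c ℕ.^ suc d)         ≡⟨ cong (pow2 u *_) (trans (ℕ→ℚ-homo-^ c (suc d)) (cong (_^ suc d) (sym (/-* (+ c) n)))) ⟩
        pow2 u * (p * ℕ→ℚ n) ^ suc d       ≡⟨ cong (pow2 u *_) (^-distrib-* p (ℕ→ℚ n) (suc d)) ⟩
        pow2 u * (p ^ suc d * ℕ→ℚ n ^ suc d) ≡⟨ *-assoc (pow2 u) (p ^ suc d) (ℕ→ℚ n ^ suc d) ⟨
        pow2 u * p ^ suc d * ℕ→ℚ n ^ suc d <⟨ *-monoˡ-<-pos (ℕ→ℚ n ^ suc d) {{^-pos (ℕ→ℚ n) {{ℕ→ℚ-pos n}} (suc d)}} pow< ⟩
        1ℚ * ℕ→ℚ n ^ suc d                 ≡⟨ *-identityˡ (ℕ→ℚ n ^ suc d) ⟩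
        ℕ→ℚ n ^ suc d                      ≡⟨ ℕ→ℚ-homo-^ n (suc d) ⟨
        ℕ→ℚ (n ℕ.^ suc d)                  ∎)
    where
    open ≤-Reasoning
    p = + c / n
    arrange : ∀ p a n D → p * a * (n * D) ≡ a * D * (p * n)
    arrange = solve 4 (λ p a n D → p :* a :* (n :* D) := a :* D :* (p :* n)) refl
      where open +-*-Solver

  *-mono-<-+ : ∀ n k {a b q} u U d₁ d₂ .{{_ : ℕ.NonZero n}} .{{_ : ℕ.NonZero d₁}} .{{_ : ℕ.NonZero d₂}} →
               q < a + b → a * ℕ→ℚ (n ℕ.* d₁) < ℤ→ℚ u * ℕ→ℚ k → b * ℕ→ℚ (n ℕ.* d₂) < ℤ→ℚ U →
               q * ℕ→ℚ (n ℕ.* (d₁ ℕ.* d₂)) < ℤ→ℚ (u ℤ.* + (k ℕ.* d₂) ℤ.+ U ℤ.* + d₁)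
  *-mono-<-+ n k {a} {b} {q} u U d₁ d₂ q<a+b a< b< = begin-strict
    q * ℕ→ℚ (n ℕ.* (d₁ ℕ.* d₂))
      <⟨ *-monoˡ-<-pos (ℕ→ℚ (n ℕ.* (d₁ ℕ.* d₂))) {{ℕ→ℚ-pos (n ℕ.* (d₁ ℕ.* d₂)) {{ℕ.m*n≢0 n (d₁ ℕ.* d₂) {{it}} {{ℕ.m*n≢0 d₁ d₂}}}}}} q<a+b ⟩
    (a + b) * ℕ→ℚ (n ℕ.* (d₁ ℕ.* d₂))
      ≡⟨ cong ((a + b) *_) (trans (ℕ→ℚ-homo-* n (d₁ ℕ.* d₂)) (cong (ℕ→ℚ n *_) (ℕ→ℚ-homo-* d₁ d₂))) ⟩
    (a + b) * (ℕ→ℚ n * (D₁ * D₂))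
      ≡⟨ split a b (ℕ→ℚ n) D₁ D₂ ⟩
    a * (ℕ→ℚ n * D₁) * D₂ + b * (ℕ→ℚ n * D₂) * D₁
      ≡⟨ cong₂ (λ x y → a * x * D₂ + b * y * D₁) (ℕ→ℚ-homo-* n d₁) (ℕ→ℚ-homo-* n d₂) ⟨
    a * ℕ→ℚ (n ℕ.* d₁) * D₂ + b * ℕ→ℚ (n ℕ.* d₂) * D₁
      <⟨ +-mono-< (*-monoˡ-<-pos D₂ {{ℕ→ℚ-pos d₂}} a<) (*-monoˡ-<-pos D₁ {{ℕ→ℚ-pos d₁}} b<) ⟩
    ℤ→ℚ u * ℕ→ℚ k * D₂ + ℤ→ℚ U * D₁
      ≡⟨ cong (_+ ℤ→ℚ U * D₁) (trans (*-assoc (ℤ→ℚ u) (ℕ→ℚ k) D₂) (cong (ℤ→ℚ u *_) (sym (ℕ→ℚ-homo-* k d₂)))) ⟩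
    ℤ→ℚ u * ℕ→ℚ (k ℕ.* d₂) + ℤ→ℚ U * D₁
      ≡⟨ cong₂ _+_ (ℤ→ℚ-homo-* u (+ (k ℕ.* d₂))) (ℤ→ℚ-homo-* U (+ d₁)) ⟨
    ℤ→ℚ (u ℤ.* + (k ℕ.* d₂)) + ℤ→ℚ (U ℤ.* + d₁)
      ≡⟨ ℤ→ℚ-homo-+ (u ℤ.* + (k ℕ.* d₂)) (U ℤ.* + d₁) ⟨
    ℤ→ℚ (u ℤ.* + (k ℕ.* d₂) ℤ.+ U ℤ.* + d₁) ∎
    where
    open ≤-Reasoning
    D₁ = ℕ→ℚ d₁
    D₂ = ℕ→ℚ d₂
    open +-*-Solver
    split : ∀ a b n D₁ D₂ → (a + b) * (n * (D₁ * D₂)) ≡ a * (n * D₁) * D₂ + b * (n * D₂) * D₁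
    split = solve 5 (λ a b n x y → (a :+ b) :* (n :* (x :* y)) := a :* (n :* x) :* y :+ b :* (n :* y) :* x) refl

  -- The multiplicative counterpart of `*-mono-<-+`: the first inequality is raised to the power
  -- `k * d₂`, the second to `d₁`, and the two are multiplied.
  pow2-mono-<-* : ∀ n k P S u U d₁ d₂ .{{_ : ℕ.NonZero k}} .{{_ : ℕ.NonZero P}} .{{_ : ℕ.NonZero d₂}} →
    pow2 u * ℕ→ℚ (k ℕ.^ d₁) < ℕ→ℚ (n ℕ.^ d₁) → pow2 U * ℕ→ℚ (P ℕ.^ d₂) ≤ ℕ→ℚ (n ℕ.^ (S ℕ.* d₂)) →
    pow2 (u ℤ.* + (k ℕ.* d₂) ℤ.+ U ℤ.* + d₁) * ℕ→ℚ ((k ℕ.^ k ℕ.* P) ℕ.^ (d₁ ℕ.* d₂)) < ℕ→ℚ (n ℕ.^ ((k ℕ.+ S) ℕ.* (d₁ ℕ.* d₂)))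
  pow2-mono-<-* n k P S u U d₁ d₂ u< U≤ = begin-strict
    pow2 (u ℤ.* + (k ℕ.* d₂) ℤ.+ U ℤ.* + d₁) * ℕ→ℚ ((k ℕ.^ k ℕ.* P) ℕ.^ (d₁ ℕ.* d₂))
      ≡⟨ cong₂ _*_ (trans (pow2-homo-+ (u ℤ.* + (k ℕ.* d₂)) (U ℤ.* + d₁)) (cong₂ _*_ (pow2-homo-* u (k ℕ.* d₂)) (pow2-homo-* U d₁)))
                   (trans (cong ℕ→ℚ regroup) (ℕ→ℚ-homo-*-^ (k ℕ.^ d₁) (k ℕ.* d₂) (P ℕ.^ d₂) d₁)) ⟩
    pow2 u ^ (k ℕ.* d₂) * pow2 U ^ d₁ * (X ^ (k ℕ.* d₂) * Y ^ d₁)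
      ≡⟨ interchange (pow2 u ^ (k ℕ.* d₂)) (pow2 U ^ d₁) (X ^ (k ℕ.* d₂)) (Y ^ d₁) ⟩
    pow2 u ^ (k ℕ.* d₂) * X ^ (k ℕ.* d₂) * (pow2 U ^ d₁ * Y ^ d₁)
      ≡⟨ cong₂ _*_ (^-distrib-* (pow2 u) X (k ℕ.* d₂)) (^-distrib-* (pow2 U) Y d₁) ⟨
    (pow2 u * X) ^ (k ℕ.* d₂) * (pow2 U * Y) ^ d₁
      <⟨ *-mono-<-≤-pos (^-nonNeg (pow2 u * X) (<⇒≤ 0<x) (k ℕ.* d₂)) (^-monoˡ-< 0<x u< (k ℕ.* d₂) {{ℕ.m*n≢0 k d₂}})
           (positive⁻¹ ((pow2 U * Y) ^ d₁) {{^-pos (pow2 U * Y) {{positive 0<y}} d₁}}) (^-monoˡ-≤ (<⇒≤ 0<y) U≤ d₁) ⟩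
    ℕ→ℚ (n ℕ.^ d₁) ^ (k ℕ.* d₂) * ℕ→ℚ (n ℕ.^ (S ℕ.* d₂)) ^ d₁
      ≡⟨ ℕ→ℚ-homo-*-^ (n ℕ.^ d₁) (k ℕ.* d₂) (n ℕ.^ (S ℕ.* d₂)) d₁ ⟨
    ℕ→ℚ ((n ℕ.^ d₁) ℕ.^ (k ℕ.* d₂) ℕ.* (n ℕ.^ (S ℕ.* d₂)) ℕ.^ d₁)
      ≡⟨ cong ℕ→ℚ collect ⟩
    ℕ→ℚ (n ℕ.^ ((k ℕ.+ S) ℕ.* (d₁ ℕ.* d₂))) ∎
    where
    open ≤-Reasoning
    X = ℕ→ℚ (k ℕ.^ d₁)
    Y = ℕ→ℚ (P ℕ.^ d₂)
    0<pow2* : ∀ i a .{{_ : ℕ.NonZero a}} → 0ℚ < pow2 i * ℕ→ℚ a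
    0<pow2* i a = positive⁻¹ (pow2 i * ℕ→ℚ a) {{pos*pos⇒pos (pow2 i) {{pow2-pos i}} (ℕ→ℚ a) {{ℕ→ℚ-pos a}}}}
    0<x : 0ℚ < pow2 u * X
    0<x = 0<pow2* u (k ℕ.^ d₁) {{ℕ.m^n≢0 k d₁}}
    0<y : 0ℚ < pow2 U * Y
    0<y = 0<pow2* U (P ℕ.^ d₂) {{ℕ.m^n≢0 P d₂}}
    ℕ→ℚ-homo-*-^ : ∀ a e b f → ℕ→ℚ (a ℕ.^ e ℕ.* b ℕ.^ f) ≡ ℕ→ℚ a ^ e * ℕ→ℚ b ^ f
    ℕ→ℚ-homo-*-^ a e b f = trans (ℕ→ℚ-homo-* (a ℕ.^ e) (b ℕ.^ f)) (cong₂ _*_ (ℕ→ℚ-homo-^ a e) (ℕ→ℚ-homo-^ b f))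
    interchange : ∀ a b c d → a * b * (c * d) ≡ a * c * (b * d)
    interchange = solve 4 (λ a b c d → a :* b :* (c :* d) := a :* c :* (b :* d)) refl
      where open +-*-Solver
    exponent₁ : ∀ k d₁ d₂ → k ℕ.* (d₁ ℕ.* d₂) ≡ d₁ ℕ.* (k ℕ.* d₂)
    exponent₁ = ℕ.solve-∀
    exponent₂ : ∀ k S d₁ d₂ → d₁ ℕ.* (k ℕ.* d₂) ℕ.+ S ℕ.* d₂ ℕ.* d₁ ≡ (k ℕ.+ S) ℕ.* (d₁ ℕ.* d₂)
    exponent₂ = ℕ.solve-∀
    regroup : (k ℕ.^ k ℕ.* P) ℕ.^ (d₁ ℕ.* d₂) ≡ (k ℕ.^ d₁) ℕ.^ (k ℕ.* d₂) ℕ.* (P ℕ.^ d₂) ℕ.^ d₁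
    regroup = trans (^-distribʳ-* (d₁ ℕ.* d₂) (k ℕ.^ k) P) (cong₂ ℕ._*_
      (trans (ℕ.^-*-assoc k k (d₁ ℕ.* d₂)) (trans (cong (k ℕ.^_) (exponent₁ k d₁ d₂)) (sym (ℕ.^-*-assoc k d₁ (k ℕ.* d₂)))))
      (trans (cong (P ℕ.^_) (ℕ.*-comm d₁ d₂)) (sym (ℕ.^-*-assoc P d₂ d₁))))
    collect : (n ℕ.^ d₁) ℕ.^ (k ℕ.* d₂) ℕ.* (n ℕ.^ (S ℕ.* d₂)) ℕ.^ d₁ ≡ n ℕ.^ ((k ℕ.+ S) ℕ.* (d₁ ℕ.* d₂))
    collect = trans (cong₂ ℕ._*_ (ℕ.^-*-assoc n d₁ (k ℕ.* d₂)) (ℕ.^-*-assoc n (S ℕ.* d₂) d₁))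
      (trans (sym (ℕ.^-distribˡ-+-* n (d₁ ℕ.* (k ℕ.* d₂)) (S ℕ.* d₂ ℕ.* d₁))) (cong (n ℕ.^_) (exponent₂ k S d₁ d₂)))

  log-cut : ∀ {a q} → 0ℚ < a → ∀ U D .{{_ : ℕ.NonZero D}} →
            q * ℕ→ℚ D < ℤ→ℚ U → pow2 U < a ^ D → cut (log a) q
  log-cut 0<a U (suc d) q< pow< = log⁺⇒log 0<a (U , d , *<⇒</ U (suc d) q< , pow<)

  selfPowers≢0 : ∀ ns → ℕ.NonZero (selfPowers ns)
  selfPowers≢0 []       = _
  selfPowers≢0 (n ∷ ns) = ℕ.m*n≢0 (n ℕ.^ n) (selfPowers ns) {{n^n≢0 n}} {{selfPowers≢0 ns}}

  module _ {m : ℕ} (n : ℕ) .{{_ : ℕ.NonZero n}} (cnt : Fin m → ℕ) where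

    partialEntropy : List (Fin m) → ℝ
    partialEntropy = foldr (λ c x → p·log[1/p] (+ cnt c / n) +ᴿ x) (ℚ→ℝ 0ℚ)

    -- With p c = cnt c / n, this says that q < U / (n d) and 2 ^ U ∼ (∏ (1 / p c) ^ cnt c) ^ d.
    LogBelow : (ℚ → ℚ → Set) → List (Fin m) → ℚ → Set
    LogBelow _∼_ cs q = ∃₂ λ U d → q * ℕ→ℚ (n ℕ.* suc d) < ℤ→ℚ U
      × (pow2 U * ℕ→ℚ (selfPowers (map cnt cs) ℕ.^ suc d)) ∼ ℕ→ℚ (n ℕ.^ (sum (map cnt cs) ℕ.* suc d))

    mutual
      -- With no colours both sides equal 1, so only the weak inequality starts the recursion; the
      -- first colour makes it strict, as the cut of `log` requires.
      partialEntropy-≤ : ∀ {cs q} → All (λ c → 0 ℕ.< cnt c) cs → cut (partialEntropy cs) q → LogBelow _≤_ cs q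
      partialEntropy-≤ {q = q} [] q<0 = + 0 , 0
        , subst (q * ℕ→ℚ (n ℕ.* 1) <_) (*-zeroˡ (ℕ→ℚ (n ℕ.* 1)))
            (*-monoˡ-<-pos (ℕ→ℚ (n ℕ.* 1)) {{ℕ→ℚ-pos (n ℕ.* 1) {{ℕ.m*n≢0 n 1}}}} q<0)
        , ≤-refl
      partialEntropy-≤ 0<cnt@(_ ∷ _) q< =
        let U , d , q<U , pow< = partialEntropy-< 0<cnt q< in U , d , q<U , <⇒≤ pow<

      partialEntropy-< : ∀ {c cs q} → All (λ c → 0 ℕ.< cnt c) (c ∷ cs) → cut (partialEntropy (c ∷ cs)) q →
                         LogBelow _<_ (c ∷ cs) q
      partialEntropy-< {c} {cs} (0<k ∷ 0<cnt) (a , b , a< , b< , q<a+b) =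
        let u , d₁ , a*< , u< = frequency-cut (cnt c) n {{ℕ.>-nonZero 0<k}} a<
            U , d₂ , b*< , U≤ = partialEntropy-≤ 0<cnt b<
        -- The second witness is `suc d₁ * suc d₂` less one, since denominators are stored as
        -- predecessors.
        in u ℤ.* + (cnt c ℕ.* suc d₂) ℤ.+ U ℤ.* + suc d₁ , d₂ ℕ.+ d₁ ℕ.* suc d₂
        , *-mono-<-+ n (cnt c) {a} {b} u U (suc d₁) (suc d₂) q<a+b a*< b*<
        , pow2-mono-<-* n (cnt c) (selfPowers (map cnt cs)) (sum (map cnt cs)) u U (suc d₁) (suc d₂)
            {{ℕ.>-nonZero 0<k}} {{selfPowers≢0 (map cnt cs)}} u< U≤

    -- Gibbs' inequality to the power `suc d` bounds the right side of `LogBelow` by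
    -- `K ^ (n * suc d)` times the self powers. These cancel, and `U / (n * suc d)` becomes a
    -- witness below log K.
    partialEntropy≤log : ∀ {cs K} → All (λ c → 0 ℕ.< cnt c) cs → sum (map cnt cs) ≡ n → length cs ℕ.≤ K →
                         partialEntropy cs ≤ᴿ log (ℕ→ℚ K)
    partialEntropy≤log {[]}             _     0≡n _ = contradiction (sym 0≡n) (ℕ.≢-nonZero⁻¹ n)
    partialEntropy≤log {cs@(_ ∷ _)} {K@(suc _)} 0<cnt Σ≡n ∣cs∣≤K q< =
      let U , d , q<U , pow< = partialEntropy-< 0<cnt q<
      in log-cut (0<ℕ→ℚ K) U (n ℕ.* suc d) {{ℕ.m*n≢0 n (suc d)}} q<U
          (*-cancelʳ-<-nonNeg (ℕ→ℚ (P ℕ.^ suc d)) {{P^-nonNeg (suc d)}}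
            (<-≤-trans pow< (≤-trans (ℕ→ℚ-mono (bound d)) (≤-reflexive
              (trans (ℕ→ℚ-homo-* (K ℕ.^ (n ℕ.* suc d)) (P ℕ.^ suc d)) (cong (_* ℕ→ℚ (P ℕ.^ suc d)) (ℕ→ℚ-homo-^ K (n ℕ.* suc d))))))))
      where
      ns = map cnt cs
      P = selfPowers ns
      P^-nonNeg : ∀ d → NonNegative (ℕ→ℚ (P ℕ.^ d))
      P^-nonNeg d = pos⇒nonNeg (ℕ→ℚ (P ℕ.^ d)) {{ℕ→ℚ-pos (P ℕ.^ d) {{ℕ.m^n≢0 P d {{selfPowers≢0 ns}}}}}}
      gibbs-n : n ℕ.^ n ℕ.≤ K ℕ.^ n ℕ.* P
      gibbs-n = ℕ.≤-trans (subst (λ s → s ℕ.^ s ℕ.≤ length ns ℕ.^ s ℕ.* P) Σ≡n (gibbs ns))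
        (ℕ.*-monoˡ-≤ P (ℕ.^-monoˡ-≤ n (ℕ.≤-trans (ℕ.≤-reflexive (length-map cnt cs)) ∣cs∣≤K)))
      bound : ∀ d → n ℕ.^ (sum ns ℕ.* suc d) ℕ.≤ K ℕ.^ (n ℕ.* suc d) ℕ.* P ℕ.^ suc d
      bound d = begin
        n ℕ.^ (sum ns ℕ.* suc d)              ≡⟨ cong (λ s → n ℕ.^ (s ℕ.* suc d)) Σ≡n ⟩
        n ℕ.^ (n ℕ.* suc d)                   ≡⟨ ℕ.^-*-assoc n n (suc d) ⟨
        (n ℕ.^ n) ℕ.^ suc d                   ≤⟨ ℕ.^-monoˡ-≤ (suc d) gibbs-n ⟩
        (K ℕ.^ n ℕ.* P) ℕ.^ suc d             ≡⟨ ^-distribʳ-* (suc d) (K ℕ.^ n) P ⟩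
        (K ℕ.^ n) ℕ.^ suc d ℕ.* P ℕ.^ suc d   ≡⟨ cong (ℕ._* P ℕ.^ suc d) (ℕ.^-*-assoc K n (suc d)) ⟩
        K ℕ.^ (n ℕ.* suc d) ℕ.* P ℕ.^ suc d   ∎
        where open ℕ.≤-Reasoning

  entropy≤log : ∀ {A : Set} {m} (Ω : List A) .{{_ : ℕ.NonZero (length Ω)}} (f : A → Fin m) {K} →
                length (range Ω f) ℕ.≤ K → entropy Ω f ≤ᴿ log (ℕ→ℚ K)
  entropy≤log Ω f {K} = partialEntropy≤log (length Ω) (count f Ω) {range Ω f} {K} (All.tabulate 0<count)
    (sum-count f (deduplicate-! Fin._≟_ (map f Ω)) Ω (λ x∈ → ∈-deduplicate⁺ Fin._≟_ (∈-map⁺ f x∈)))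
    where
    0<count : ∀ {c} → c ∈ range Ω f → 0 ℕ.< count f Ω c
    0<count c∈ with x , x∈ , refl ← ∈-map⁻ f (∈-deduplicate⁻ Fin._≟_ (map f Ω) c∈) =
      filter-some (λ y → f y Fin.≟ f x) (lose x∈ refl)

open import Data.Fin using (Fin)
open import Data.Fin.Subset using (Subset; ∣_∣)
open import Data.Nat using (ℕ; suc; _+_; _∸_; _^_; _≤_)
open import Data.Nat.Properties using (≤-reflexive)
open import Data.Product using (Σ-syntax; _×_)
open import Relation.Binary.PropositionalEquality using (_≡_)
open import Defs using (ℕ→ℚ; 2ℚ; 2ℚ-nonNegative; ℕ→ℝ; _≤ᴿ_; _+ᴿ_; _·_; log; tower₂; Subset≤; #colours; colourEntropy)

theorem6p3 : (k m i N : ℕ) → 2 ≤ k → i ≤ k → 2 ≤ m → m ≤ 2 ^ k →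
    tower₂ (suc i) (ℕ→ℝ k +ᴿ 2ℚ · log (ℕ→ℚ k) +ᴿ ℕ→ℝ 2) ≤ᴿ ℕ→ℝ N →
    (φ : Subset≤ N k → Fin m) →
    Σ[ V ∈ Subset N ] Σ[ ∣V∣≡k ∈ ∣ V ∣ ≡ k ]
    #colours φ V (≤-reflexive ∣V∣≡k) ≤ 2 ^ (k ∸ i) + i
    × colourEntropy φ V (≤-reflexive ∣V∣≡k) ≤ᴿ log (ℕ→ℚ (2 ^ (k ∸ i) + i))
theorem6p3 k m i N 2≤k i≤k 2≤m m≤2^k tower≤N φ =
  let bound = RealTower.ramseyBound≤N {k} {m} {i} {N} 2≤k i≤k m≤2^k tower≤N
      V , ∣V∣≡k , few = SubsetsAsLists.fewColouredSubset {k} {m} {i} {N} 2≤m i≤k bound φ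
  in V , ∣V∣≡k , few
   , EntropyBound.entropy≤log (subsetsOf V (≤-reflexive ∣V∣≡k)) {{subsetsOf-nonZero V (≤-reflexive ∣V∣≡k)}} φ few
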